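{- Let $a\ge 0$ be a real number, let $G$ be a connected graph of order $n$ with minimum degree $\delta\le\frac{n-1}{2}$, and let $\overline{G}$ be the complement of $G$. If $$\lambda_{1}(aD(\overline{G})+A(\overline{G}))<(a+1)\delta,$$ then $G$ has a fractional perfect matching.
   Context: Graphs are finite, simple and undirected. For a graph $H$, $A(H)$ is the adjacency matrix, $D(H)$ is the diagonal matrix of vertex degrees, and $\lambda_1(M)$ denotes the largest eigenvalue of a real symmetric matrix $M$. A fractional matching of $G$ is a function $f:E(G)\to[0,1]$ such that for every vertex $v$ the sum of $f(e)$ over all edges $e$ incident with $v$ is at most $1$. It is a fractional perfect matching if $\sum_{e\in E(G)}f(e)=n/2$. -}

module Defs where

open import Level using (0ℓ)
open import Algebra.Bundles.Raw using (RawMonoid)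
import Algebra.Definitions.RawMonoid as RawMonoidDefinitions
open import Data.Bool.Base using (Bool; false; not; if_then_else_; _∧_; _∨_; T)
open import Data.Fin.Base using (Fin)
open import Data.Fin.Properties using (_≟_; _<?_)
open import Data.Fin.Subset using (Subset; ∣_∣)
open import Data.Integer.Base using (+_)
open import Data.List.Base using (List; length; lookup; allFin; cartesianProduct; filterᵇ)
open import Data.Nat.Base as ℕ using (ℕ)
import Data.Nat.Properties as ℕ
open import Data.Product using (_×_; _,_; ∃-syntax)
open import Data.Rational.Base as ℚ using (ℚ; 0ℚ; 1ℚ; ½)
import Data.Rational.Properties as ℚ
open import Data.Rational.Solver using (module +-*-Solver)
open import Data.Vec.Base using (tabulate)
open import Data.Vec.Functional using (Vector)
open import Relation.Binary.Construct.Closure.ReflexiveTransitive using (Star)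
open import Relation.Binary.PropositionalEquality
  using (_≡_; refl; sym; trans; cong; cong₂; subst)
open import Relation.Nullary using (¬_; yes; no; does; contradiction)

-- Real numbers as Cauchy sequences of rationals up to null sequences (_≈ℝ_).
-- A proof of IsCauchy contains a modulus of convergence.

IsCauchy : (ℕ → ℚ) → Set
IsCauchy x = ∀ ε → 0ℚ ℚ.< ε →
  ∃[ N ] ∀ m n → N ℕ.≤ m → N ℕ.≤ n → ℚ.∣ x m ℚ.- x n ∣ ℚ.< ε

record ℝ : Set where
  constructor mkℝ
  field
    seq    : ℕ → ℚ
    cauchy : IsCauchy seq

open ℝ public

infix 4 _≈ℝ_ _<ℝ_ _≤ℝ_

_≈ℝ_ : ℝ → ℝ → Set
x ≈ℝ y = ∀ ε → 0ℚ ℚ.< ε →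
  ∃[ N ] ∀ n → N ℕ.≤ n → ℚ.∣ seq x n ℚ.- seq y n ∣ ℚ.< ε

_<ℝ_ : ℝ → ℝ → Set
x <ℝ y = ∃[ ε ] 0ℚ ℚ.< ε ×
  ∃[ N ] ∀ n → N ℕ.≤ n → seq x n ℚ.+ ε ℚ.< seq y n

_≤ℝ_ : ℝ → ℝ → Set
x ≤ℝ y = ¬ (y <ℝ x)

fromℚ : ℚ → ℝ
fromℚ q = mkℝ (λ _ → q) λ ε 0<ε → 0 , λ _ _ _ _ →
  subst (ℚ._< ε) (sym (cong ℚ.∣_∣ (ℚ.+-inverseʳ q))) 0<ε

fromℕ : ℕ → ℝ
fromℕ n = fromℚ (+ n ℚ./ 1)

0ℝ 1ℝ : ℝ
0ℝ = fromℚ 0ℚ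
1ℝ = fromℚ 1ℚ

private
  half-pos : ∀ {ε} → 0ℚ ℚ.< ε → 0ℚ ℚ.< ½ ℚ.* ε
  half-pos 0<ε = ℚ.*-monoʳ-<-pos ½ 0<ε

  halves : ∀ ε → ½ ℚ.* ε ℚ.+ ½ ℚ.* ε ≡ ε
  halves ε = trans (sym (ℚ.*-distribʳ-+ ε ½ ½)) (ℚ.*-identityˡ ε)

  cauchy-+ : ∀ x y → IsCauchy x → IsCauchy y → IsCauchy (λ n → x n ℚ.+ y n)
  cauchy-+ x y cx cy ε 0<ε
    with cx _ (half-pos 0<ε) | cy _ (half-pos 0<ε)
  ... | N , hx | M , hy = N ℕ.⊔ M , λ m n p q → begin-strict
    ℚ.∣ (x m ℚ.+ y m) ℚ.- (x n ℚ.+ y n) ∣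
      ≡⟨ cong ℚ.∣_∣ (rearrange (x m) (y m) (x n) (y n)) ⟩
    ℚ.∣ (x m ℚ.- x n) ℚ.+ (y m ℚ.- y n) ∣
      ≤⟨ ℚ.∣p+q∣≤∣p∣+∣q∣ (x m ℚ.- x n) (y m ℚ.- y n) ⟩
    ℚ.∣ x m ℚ.- x n ∣ ℚ.+ ℚ.∣ y m ℚ.- y n ∣
      <⟨ ℚ.+-mono-<
           (hx m n (ℕ.m⊔n≤o⇒m≤o N M p) (ℕ.m⊔n≤o⇒m≤o N M q))
           (hy m n (ℕ.m⊔n≤o⇒n≤o N M p) (ℕ.m⊔n≤o⇒n≤o N M q)) ⟩
    ½ ℚ.* ε ℚ.+ ½ ℚ.* ε
      ≡⟨ halves ε ⟩
    ε ∎
    where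
    open ℚ.≤-Reasoning
    open +-*-Solver
    rearrange : ∀ a b c d →
      (a ℚ.+ b) ℚ.- (c ℚ.+ d) ≡ (a ℚ.- c) ℚ.+ (b ℚ.- d)
    rearrange = solve 4 (λ a b c d →
      (a :+ b) :- (c :+ d) := (a :- c) :+ (b :- d)) refl

  bounded : ∀ x → IsCauchy x →
    ∃[ B ] 0ℚ ℚ.< B × ∃[ N ] ∀ n → N ℕ.≤ n → ℚ.∣ x n ∣ ℚ.≤ B
  bounded x cx with cx 1ℚ (ℚ.positive⁻¹ 1ℚ)
  ... | N , h = ℚ.∣ x N ∣ ℚ.+ 1ℚ
              , ℚ.+-mono-≤-< (ℚ.0≤∣p∣ (x N)) (ℚ.positive⁻¹ 1ℚ)
              , N , λ n p → begin
    ℚ.∣ x n ∣                         ≡⟨ cong ℚ.∣_∣ (split (x n) (x N)) ⟩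
    ℚ.∣ x N ℚ.+ (x n ℚ.- x N) ∣       ≤⟨ ℚ.∣p+q∣≤∣p∣+∣q∣ (x N) (x n ℚ.- x N) ⟩
    ℚ.∣ x N ∣ ℚ.+ ℚ.∣ x n ℚ.- x N ∣   ≤⟨ ℚ.+-monoʳ-≤ ℚ.∣ x N ∣
                                           (ℚ.<⇒≤ (h n N p ℕ.≤-refl)) ⟩
    ℚ.∣ x N ∣ ℚ.+ 1ℚ                  ∎
    where
    open ℚ.≤-Reasoning
    open +-*-Solver
    split : ∀ a b → a ≡ b ℚ.+ (a ℚ.- b)
    split = solve 2 (λ a b → a := b :+ (a :- b)) refl

  apportion : ∀ {B C ε} → 0ℚ ℚ.< B → 0ℚ ℚ.< C → 0ℚ ℚ.< ε →
    ∃[ η ] 0ℚ ℚ.< η × B ℚ.* η ℚ.+ C ℚ.* η ≡ ε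
  apportion {B} {C} {ε} 0<B 0<C 0<ε = go (B ℚ.+ C) refl (ℚ.positive (ℚ.+-mono-< 0<B 0<C))
    where
    open ℚ.≤-Reasoning
    go : ∀ S → B ℚ.+ C ≡ S → ℚ.Positive S →
      ∃[ η ] 0ℚ ℚ.< η × B ℚ.* η ℚ.+ C ℚ.* η ≡ ε
    go S B+C≡S S-pos = S⁻¹ ℚ.* ε , 0<η , total
      where
      S-nonZero : ℚ.NonZero S
      S-nonZero = ℚ.pos⇒nonZero S {{S-pos}}

      S⁻¹ : ℚ
      S⁻¹ = ℚ.1/_ S {{S-nonZero}}

      0<η : 0ℚ ℚ.< S⁻¹ ℚ.* ε
      0<η = ℚ.positive⁻¹ (S⁻¹ ℚ.* ε)
        {{ℚ.pos*pos⇒pos S⁻¹ {{ℚ.1/pos⇒pos S {{S-pos}}}} ε {{ℚ.positive 0<ε}}}}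

      total : B ℚ.* (S⁻¹ ℚ.* ε) ℚ.+ C ℚ.* (S⁻¹ ℚ.* ε) ≡ ε
      total = begin-equality
        B ℚ.* (S⁻¹ ℚ.* ε) ℚ.+ C ℚ.* (S⁻¹ ℚ.* ε)
                               ≡⟨ ℚ.*-distribʳ-+ (S⁻¹ ℚ.* ε) B C ⟨
        (B ℚ.+ C) ℚ.* (S⁻¹ ℚ.* ε)
                               ≡⟨ cong (ℚ._* (S⁻¹ ℚ.* ε)) B+C≡S ⟩
        S ℚ.* (S⁻¹ ℚ.* ε)      ≡⟨ ℚ.*-assoc S S⁻¹ ε ⟨
        (S ℚ.* S⁻¹) ℚ.* ε      ≡⟨ cong (ℚ._* ε) (ℚ.*-inverseʳ S {{S-nonZero}}) ⟩
        1ℚ ℚ.* ε               ≡⟨ ℚ.*-identityˡ ε ⟩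
        ε                      ∎

  ∣p*q∣<D*η : ∀ {D p q η} → 0ℚ ℚ.< D →
    ℚ.∣ p ∣ ℚ.≤ D → ℚ.∣ q ∣ ℚ.< η → ℚ.∣ p ℚ.* q ∣ ℚ.< D ℚ.* η
  ∣p*q∣<D*η {D} {p} {q} {η} 0<D p≤D q<η = begin-strict
    ℚ.∣ p ℚ.* q ∣          ≡⟨ ℚ.∣p*q∣≡∣p∣*∣q∣ p q ⟩
    ℚ.∣ p ∣ ℚ.* ℚ.∣ q ∣    ≤⟨ ℚ.*-monoʳ-≤-nonNeg ℚ.∣ q ∣
                                {{ℚ.nonNegative (ℚ.0≤∣p∣ q)}} p≤D ⟩
    D ℚ.* ℚ.∣ q ∣          <⟨ ℚ.*-monoʳ-<-pos D {{ℚ.positive 0<D}} q<η ⟩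
    D ℚ.* η                ∎
    where open ℚ.≤-Reasoning

  cauchy-*-close : ∀ (x y : ℕ → ℚ) {B C η ε} → 0ℚ ℚ.< B → 0ℚ ℚ.< C →
    B ℚ.* η ℚ.+ C ℚ.* η ≡ ε →
    ∀ N₁ → (∀ n → N₁ ℕ.≤ n → ℚ.∣ x n ∣ ℚ.≤ B) →
    ∀ N₂ → (∀ n → N₂ ℕ.≤ n → ℚ.∣ y n ∣ ℚ.≤ C) →
    ∀ N₃ → (∀ m n → N₃ ℕ.≤ m → N₃ ℕ.≤ n → ℚ.∣ x m ℚ.- x n ∣ ℚ.< η) →
    ∀ N₄ → (∀ m n → N₄ ℕ.≤ m → N₄ ℕ.≤ n → ℚ.∣ y m ℚ.- y n ∣ ℚ.< η) →
    ∃[ N ] ∀ m n → N ℕ.≤ m → N ℕ.≤ n → ℚ.∣ x m ℚ.* y m ℚ.- x n ℚ.* y n ∣ ℚ.< ε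
  cauchy-*-close x y {B} {C} {η} {ε} 0<B 0<C total N₁ hB N₂ hC N₃ hx N₄ hy =
    (N₁ ℕ.⊔ N₂) ℕ.⊔ (N₃ ℕ.⊔ N₄) , λ m n p q → begin-strict
    ℚ.∣ x m ℚ.* y m ℚ.- x n ℚ.* y n ∣
      ≡⟨ cong ℚ.∣_∣ (rearrange (x m) (y m) (x n) (y n)) ⟩
    ℚ.∣ x m ℚ.* (y m ℚ.- y n) ℚ.+ y n ℚ.* (x m ℚ.- x n) ∣
      ≤⟨ ℚ.∣p+q∣≤∣p∣+∣q∣ (x m ℚ.* (y m ℚ.- y n)) (y n ℚ.* (x m ℚ.- x n)) ⟩
    ℚ.∣ x m ℚ.* (y m ℚ.- y n) ∣ ℚ.+ ℚ.∣ y n ℚ.* (x m ℚ.- x n) ∣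
      <⟨ ℚ.+-mono-<
           (∣p*q∣<D*η {B} {x m} {y m ℚ.- y n} 0<B (hB m (N₁≤ (lower p)))
             (hy m n (N₄≤ (upper p)) (N₄≤ (upper q))))
           (∣p*q∣<D*η {C} {y n} {x m ℚ.- x n} 0<C (hC n (N₂≤ (lower q)))
             (hx m n (N₃≤ (upper p)) (N₃≤ (upper q)))) ⟩
    B ℚ.* η ℚ.+ C ℚ.* η
      ≡⟨ total ⟩
    ε ∎
    where
    open ℚ.≤-Reasoning
    open +-*-Solver
    lower : ∀ {k} → (N₁ ℕ.⊔ N₂) ℕ.⊔ (N₃ ℕ.⊔ N₄) ℕ.≤ k → (N₁ ℕ.⊔ N₂) ℕ.≤ k
    lower = ℕ.m⊔n≤o⇒m≤o (N₁ ℕ.⊔ N₂) (N₃ ℕ.⊔ N₄)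
    upper : ∀ {k} → (N₁ ℕ.⊔ N₂) ℕ.⊔ (N₃ ℕ.⊔ N₄) ℕ.≤ k → (N₃ ℕ.⊔ N₄) ℕ.≤ k
    upper = ℕ.m⊔n≤o⇒n≤o (N₁ ℕ.⊔ N₂) (N₃ ℕ.⊔ N₄)
    N₁≤ : ∀ {k} → N₁ ℕ.⊔ N₂ ℕ.≤ k → N₁ ℕ.≤ k
    N₁≤ = ℕ.m⊔n≤o⇒m≤o N₁ N₂
    N₂≤ : ∀ {k} → N₁ ℕ.⊔ N₂ ℕ.≤ k → N₂ ℕ.≤ k
    N₂≤ = ℕ.m⊔n≤o⇒n≤o N₁ N₂
    N₃≤ : ∀ {k} → N₃ ℕ.⊔ N₄ ℕ.≤ k → N₃ ℕ.≤ k
    N₃≤ = ℕ.m⊔n≤o⇒m≤o N₃ N₄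
    N₄≤ : ∀ {k} → N₃ ℕ.⊔ N₄ ℕ.≤ k → N₄ ℕ.≤ k
    N₄≤ = ℕ.m⊔n≤o⇒n≤o N₃ N₄

    rearrange : ∀ a b c d →
      a ℚ.* b ℚ.- c ℚ.* d ≡ a ℚ.* (b ℚ.- d) ℚ.+ d ℚ.* (a ℚ.- c)
    rearrange a b c d = sym (begin-equality
      a ℚ.* (b ℚ.- d) ℚ.+ d ℚ.* (a ℚ.- c)
        ≡⟨ cong₂ ℚ._+_ (expand a b d) (expand d a c) ⟩
      (a ℚ.* b ℚ.- a ℚ.* d) ℚ.+ (d ℚ.* a ℚ.- d ℚ.* c)
        ≡⟨ cong₂ (λ s t → (a ℚ.* b ℚ.- a ℚ.* d) ℚ.+ (s ℚ.- t)) (ℚ.*-comm d a) (ℚ.*-comm d c) ⟩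
      (a ℚ.* b ℚ.- a ℚ.* d) ℚ.+ (a ℚ.* d ℚ.- c ℚ.* d)
        ≡⟨ telescope (a ℚ.* b) (a ℚ.* d) (c ℚ.* d) ⟩
      a ℚ.* b ℚ.- c ℚ.* d ∎)
      where
      expand : ∀ s t u → s ℚ.* (t ℚ.- u) ≡ s ℚ.* t ℚ.- s ℚ.* u
      expand s t u = trans (ℚ.*-distribˡ-+ s t (ℚ.- u))
                           (cong (s ℚ.* t ℚ.+_) (sym (ℚ.neg-distribʳ-* s u)))

      telescope : ∀ s t u → (s ℚ.- t) ℚ.+ (t ℚ.- u) ≡ s ℚ.- u
      telescope = solve 3 (λ s t u → (s :- t) :+ (t :- u) := s :- u) refl

  cauchy-* : ∀ x y → IsCauchy x → IsCauchy y → IsCauchy (λ n → x n ℚ.* y n)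
  cauchy-* x y cx cy ε 0<ε =
    let B , 0<B , N₁ , hB = bounded x cx
        C , 0<C , N₂ , hC = bounded y cy
        η , 0<η , total   = apportion 0<B 0<C 0<ε
        N₃ , hx = cx η 0<η
        N₄ , hy = cy η 0<η
    in cauchy-*-close x y 0<B 0<C total N₁ hB N₂ hC N₃ hx N₄ hy

infixl 6 _+ℝ_
infixl 7 _*ℝ_

_+ℝ_ : ℝ → ℝ → ℝ
x +ℝ y = mkℝ (λ n → seq x n ℚ.+ seq y n) (cauchy-+ (seq x) (seq y) (cauchy x) (cauchy y))

_*ℝ_ : ℝ → ℝ → ℝ
x *ℝ y = mkℝ (λ n → seq x n ℚ.* seq y n) (cauchy-* (seq x) (seq y) (cauchy x) (cauchy y))

+ℝ-rawMonoid : RawMonoid 0ℓ 0ℓ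
+ℝ-rawMonoid = record { Carrier = ℝ ; _≈_ = _≈ℝ_ ; _∙_ = _+ℝ_ ; ε = 0ℝ }

open RawMonoidDefinitions +ℝ-rawMonoid public using (sum)

Matrix : ℕ → Set
Matrix n = Fin n → Fin n → ℝ

infixr 7 _·_

_·_ : ∀ {n} → Matrix n → Vector ℝ n → Vector ℝ n
(M · x) i = sum λ j → M i j *ℝ x j

IsEigenvalue : ∀ {n} → Matrix n → ℝ → Set
IsEigenvalue {n} M μ = ∃[ x ]
  ¬ (∀ i → x i ≈ℝ 0ℝ) × (∀ i → (M · x) i ≈ℝ μ *ℝ x i)

-- "μ = λ₁(M)", as a relation.
IsLargestEigenvalue : ∀ {n} → Matrix n → ℝ → Set
IsLargestEigenvalue M μ = IsEigenvalue M μ × (∀ ν → IsEigenvalue M ν → ν ≤ℝ μ)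

record Graph (n : ℕ) : Set where
  field
    adj       : Fin n → Fin n → Bool
    symmetric : ∀ u v → adj u v ≡ adj v u
    loopless  : ∀ v → adj v v ≡ false

open Graph public

complement : ∀ {n} → Graph n → Graph n
complement {n} G = record
  { adj       = adj′
  ; symmetric = λ u v → cong₂ (λ b c → not b ∧ not c) (≟-symmetric u v) (symmetric G u v)
  ; loopless  = loopless′
  }
  where
  adj′ : Fin n → Fin n → Bool
  adj′ u v = not (does (u ≟ v)) ∧ not (adj G u v)

  ≟-symmetric : ∀ u v → does (u ≟ v) ≡ does (v ≟ u)
  ≟-symmetric u v with u ≟ v | v ≟ u
  ... | yes _ | yes _ = refl
  ... | no _  | no _  = refl
  ... | yes p | no ¬q = contradiction (sym p) ¬q
  ... | no ¬p | yes q = contradiction (sym q) ¬p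

  loopless′ : ∀ v → adj′ v v ≡ false
  loopless′ v with v ≟ v
  ... | yes _ = refl
  ... | no ¬p = contradiction refl ¬p

neighbours : ∀ {n} → Graph n → Fin n → Subset n
neighbours G v = tabulate (adj G v)

degree : ∀ {n} → Graph n → Fin n → ℕ
degree G v = ∣ neighbours G v ∣

-- No graph of order 0 has a minimum degree.
IsMinDegree : ∀ {n} → Graph n → ℕ → Set
IsMinDegree G δ = (∃[ v ] degree G v ≡ δ) × (∀ v → δ ℕ.≤ degree G v)

Connected : ∀ {n} → Graph n → Set
Connected G = ∀ u v → Star (λ x y → T (adj G x y)) u v

adjacencyMatrix : ∀ {n} → Graph n → Matrix n
adjacencyMatrix G u v = if adj G u v then 1ℝ else 0ℝ

degreeMatrix : ∀ {n} → Graph n → Matrix n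
degreeMatrix G u v = if does (u ≟ v) then fromℕ (degree G u) else 0ℝ

aD+A : ∀ {n} → ℝ → Graph n → Matrix n
aD+A a G u v = a *ℝ degreeMatrix G u v +ℝ adjacencyMatrix G u v

-- Each edge {u, v} is listed exactly once, as the pair (u , v) with u < v.
edges : ∀ {n} → Graph n → List (Fin n × Fin n)
edges {n} G = filterᵇ (λ (u , v) → does (u <? v) ∧ adj G u v)
                      (cartesianProduct (allFin n) (allFin n))

-- E(G), as positions in the list of edges.
Edge : ∀ {n} → Graph n → Set
Edge G = Fin (length (edges G))

incident : ∀ {n} (G : Graph n) → Fin n → Edge G → Bool
incident G v e = let (u , w) = lookup (edges G) e in does (v ≟ u) ∨ does (v ≟ w)

IsFractionalMatching : ∀ {n} (G : Graph n) → (Edge G → ℝ) → Set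
IsFractionalMatching G f =
  (∀ e → 0ℝ ≤ℝ f e × f e ≤ℝ 1ℝ) ×
  (∀ v → sum (λ e → if incident G v e then f e else 0ℝ) ≤ℝ 1ℝ)

IsFractionalPerfectMatching : ∀ {n} (G : Graph n) → (Edge G → ℝ) → Set
IsFractionalPerfectMatching {n} G f =
  IsFractionalMatching G f × sum f ≈ℝ fromℚ (+ n ℚ./ 2)

HasFractionalPerfectMatching : ∀ {n} → Graph n → Set
HasFractionalPerfectMatching G = ∃[ f ] IsFractionalPerfectMatching G f

{-# OPTIONS --safe #-}

module Submission where

-- By Hall's theorem, either some permutation σ sends every vertex v of G to a neighbour, and weight ½ on
-- each edge {v, σ v} gives a fractional perfect matching, or some X has fewer neighbours than elements.
-- In the second case T = X ∖ N(X) is independent and larger than N(X) ∖ X, which contains the whole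
-- neighbourhood of each t ∈ T, so that ∣T∣ > δ.  Now T is a clique of the complement, and the Rayleigh
-- quotient of aD + A at the indicator vector of T is at least (a + 1) δ.
--
-- The Rayleigh bound needs an actual eigenvalue, but the reals are Cauchy sequences and no choice is
-- available.  Fix a rational q between λ₁ and (a + 1) δ.  Positive semidefiniteness of rational matrices is
-- decidable by Schur complements, so the k-th rational approximation of M yields a rational ν k ≥ q that is,
-- up to 1/(k + 1), the least shift making ν k I − M k positive semidefinite.  These form a real number ν.
-- As a limit of positive semidefinite forms, ν I − M is not not singular or coercive; a coercive form
-- would leave room below ν k, so ν is an eigenvalue of M above λ₁.

open import Defs
open import Algebra.Bundles using (CommutativeRing)
import Algebra.Properties.Semiring.Sum as SemiringSum
open import Data.Bool.Base using (Bool; true; false; if_then_else_; _∧_; _∨_; not)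
open import Data.Bool.Properties using (∨-comm)
open import Data.Fin.Base as Fin using (Fin; zero; suc)
import Data.Fin.Properties as Fin
open import Data.Fin.Subset as Subset
  using (Subset; _∈_; _∉_; _⊆_; _∪_; _∩_; _─_; ⁅_⁆; Nonempty; inside; outside)
import Data.Fin.Subset.Properties as Subset
import Data.Integer.Base as ℤ
import Data.Integer.Properties as ℤ
open import Data.List.Base as List using (List; []; _∷_; _++_; length; lookup; filterᵇ; cartesianProduct)
open import Data.Nat.Base as ℕ using (ℕ; zero; suc)
import Data.Nat.Properties as ℕ
open import Data.Product using (_×_; _,_; proj₁; proj₂; ∃-syntax)
import Data.Rational.Unnormalised.Base as ℚᵘ
import Data.Rational.Unnormalised.Properties as ℚᵘ
open import Data.Sum.Base using (_⊎_; inj₁; inj₂)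
open import Data.Vec.Base as Vec using ([]; _∷_; tabulate)
open import Data.Vec.Functional as Vector using (Vector)
open import Data.Vec.Properties using ([]=⇒lookup; lookup⇒[]=; lookup∘tabulate)
open import Function.Base using (_∘_; id; _⟨_⟩_)
open import Relation.Binary.Definitions using (tri<; tri≈; tri>)
open import Relation.Binary.PropositionalEquality
open import Relation.Nullary
open import Relation.Nullary.Decidable using (_×-dec_; ¬?; dec-true; dec-false; dec⇒maybe; map′)
open import Tactic.RingSolver using (solve-∀)
open import Tactic.RingSolver.Core.AlmostCommutativeRing using (AlmostCommutativeRing; fromCommutativeRing)

-- The matching is wanted as data, but the dichotomy behind it ranges over finitely many subsets and
-- is decidable. Analysis enters only in the violating branch, where the goal is a contradiction, so
-- each case distinction on real numbers may stay under a double negation.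
--
-- `IsLargestEigenvalue` speaks only of eigenvalues that come with an eigenvector, so a large
-- Rayleigh quotient is no contradiction until such a pair is produced; compactness of the sphere,
-- its usual source, is not constructive.
--
-- The bound (a + 1) δ arises row by row. In the complement a vertex of T has at least ∣T∣ - 1 ≥ δ
-- neighbours inside T, which gives δ from A and at least a δ from a D. Since `0ℝ ≤ℝ a` is itself a
-- negation, the approximations of a are only eventually above -η for each η > 0; the gap between q
-- and (a + 1) δ pays for that.

module HallTheorem where

  open import Data.Nat.Base using (_+_; _≤_; _<_; z≤n; s≤s)
  open import Data.Nat.Properties
  open import Data.Fin.Subset using (∣_∣) renaming (_-_ to _─′_)

  private variable
    m n : ℕ

  -- Cardinalities of finite subsets

  ∈-tabulate⁺ : ∀ (f : Fin n → _) {i} → f i ≡ true → i ∈ tabulate f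
  ∈-tabulate⁺ f {i} fi = lookup⇒[]= i (tabulate f) (trans (lookup∘tabulate f i) fi)

  ∈-tabulate⁻ : ∀ (f : Fin n → _) {i} → i ∈ tabulate f → f i ≡ true
  ∈-tabulate⁻ f {i} i∈ = trans (sym (lookup∘tabulate f i)) ([]=⇒lookup i∈)

  ∣p∪q∣+∣p∩q∣ : ∀ (p q : Subset n) → ∣ p ∪ q ∣ + ∣ p ∩ q ∣ ≡ ∣ p ∣ + ∣ q ∣
  ∣p∪q∣+∣p∩q∣ []            []            = refl
  ∣p∪q∣+∣p∩q∣ (outside ∷ p) (outside ∷ q) = ∣p∪q∣+∣p∩q∣ p q
  ∣p∪q∣+∣p∩q∣ (inside ∷ p)  (outside ∷ q) = cong suc (∣p∪q∣+∣p∩q∣ p q)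
  ∣p∪q∣+∣p∩q∣ (outside ∷ p) (inside ∷ q)  = trans (cong suc (∣p∪q∣+∣p∩q∣ p q)) (sym (+-suc ∣ p ∣ ∣ q ∣))
  ∣p∪q∣+∣p∩q∣ (inside ∷ p)  (inside ∷ q)  = cong suc (begin
    ∣ p ∪ q ∣ + suc ∣ p ∩ q ∣    ≡⟨ +-suc ∣ p ∪ q ∣ ∣ p ∩ q ∣ ⟩
    suc (∣ p ∪ q ∣ + ∣ p ∩ q ∣)  ≡⟨ cong suc (∣p∪q∣+∣p∩q∣ p q) ⟩
    suc (∣ p ∣ + ∣ q ∣)          ≡⟨ +-suc ∣ p ∣ ∣ q ∣ ⟨
    ∣ p ∣ + suc ∣ q ∣            ∎)
    where open ≡-Reasoning

  ∣p─q∣+∣p∩q∣ : ∀ (p q : Subset n) → ∣ p ─ q ∣ + ∣ p ∩ q ∣ ≡ ∣ p ∣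
  ∣p─q∣+∣p∩q∣ []            []            = refl
  ∣p─q∣+∣p∩q∣ (outside ∷ p) (outside ∷ q) = ∣p─q∣+∣p∩q∣ p q
  ∣p─q∣+∣p∩q∣ (inside ∷ p)  (outside ∷ q) = cong suc (∣p─q∣+∣p∩q∣ p q)
  ∣p─q∣+∣p∩q∣ (outside ∷ p) (inside ∷ q)  = ∣p─q∣+∣p∩q∣ p q
  ∣p─q∣+∣p∩q∣ (inside ∷ p)  (inside ∷ q)  = trans (+-suc ∣ p ─ q ∣ ∣ p ∩ q ∣) (cong suc (∣p─q∣+∣p∩q∣ p q))

  x∈p─q⇒x∉q : ∀ (p q : Subset n) {x} → x ∈ p ─ q → x ∉ q
  x∈p─q⇒x∉q (_ ∷ p) (inside  ∷ q) {zero}  () _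
  x∈p─q⇒x∉q (_ ∷ p) (outside ∷ q) {zero}  _  ()
  x∈p─q⇒x∉q (_ ∷ p) (inside  ∷ q) {suc x} h  x∈q = x∈p─q⇒x∉q p q (Subset.drop-there h) (Subset.drop-there x∈q)
  x∈p─q⇒x∉q (_ ∷ p) (outside ∷ q) {suc x} h  x∈q = x∈p─q⇒x∉q p q (Subset.drop-there h) (Subset.drop-there x∈q)

  ∣p∣≤1+∣p-x∣ : ∀ (p : Subset n) x → ∣ p ∣ ≤ suc ∣ p ─′ x ∣
  ∣p∣≤1+∣p-x∣ p x = begin
    ∣ p ∣                          ≡⟨ ∣p─q∣+∣p∩q∣ p ⁅ x ⁆ ⟨
    ∣ p ─′ x ∣ + ∣ p ∩ ⁅ x ⁆ ∣     ≤⟨ +-monoʳ-≤ ∣ p ─′ x ∣ (Subset.∣p∩q∣≤∣q∣ p ⁅ x ⁆) ⟩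
    ∣ p ─′ x ∣ + ∣ ⁅ x ⁆ ∣         ≡⟨ cong (∣ p ─′ x ∣ +_) (Subset.∣⁅x⁆∣≡1 x) ⟩
    ∣ p ─′ x ∣ + 1                 ≡⟨ +-comm ∣ p ─′ x ∣ 1 ⟩
    suc ∣ p ─′ x ∣                 ∎
    where open ≤-Reasoning

  0<∣p∣⇒Nonempty : ∀ (p : Subset n) → 0 < ∣ p ∣ → Nonempty p
  0<∣p∣⇒Nonempty {n} p 0<∣p∣ with Subset.nonempty? p
  ... | yes nonempty = nonempty
  ... | no  empty    = contradiction (trans (cong ∣_∣ (Subset.Empty-unique empty)) (Subset.∣⊥∣≡0 n)) (>⇒≢ 0<∣p∣)

  -- Hall's condition and transversals

  image : (Fin m → Subset n) → Subset m → Subset n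
  image R X = tabulate λ w → does (Fin.any? λ v → v Subset.∈? X ×-dec w Subset.∈? R v)

  ∈-image⁺ : ∀ (R : Fin m → Subset n) {X v w} → v ∈ X → w ∈ R v → w ∈ image R X
  ∈-image⁺ R {X} {v} {w} v∈X w∈Rv = ∈-tabulate⁺ _ (dec-true
        (Fin.any? λ v → v Subset.∈? X ×-dec w Subset.∈? R v) (v , v∈X , w∈Rv))

  ∈-image⁻ : ∀ (R : Fin m → Subset n) {X w} → w ∈ image R X → ∃[ v ] v ∈ X × w ∈ R v
  ∈-image⁻ R {X} {w} w∈ with Fin.any? (λ v → v Subset.∈? X ×-dec w Subset.∈? R v) | ∈-tabulate⁻ _ w∈
  ... | yes v | _ = v

  Hall : (Fin m → Subset n) → Set
  Hall R = ∀ X → ∣ X ∣ ≤ ∣ image R X ∣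

  Violation : (Fin m → Subset n) → Set
  Violation R = ∃[ X ] ∣ image R X ∣ < ∣ X ∣

  hall-or-violation : (R : Fin m → Subset n) → Hall R ⊎ Violation R
  hall-or-violation R with Subset.anySubset? (λ X → ∣ image R X ∣ <? ∣ X ∣)
  ... | yes violation = inj₂ violation
  ... | no ¬violation = inj₁ λ X → ≮⇒≥ λ lt → ¬violation (X , lt)

  delete : (Fin m → Subset n) → Fin m → Fin n → Fin m → Subset n
  delete R v y u with u Fin.≟ v
  ... | yes _ = R u ─′ y
  ... | no  _ = R u

  delete-self : ∀ (R : Fin m → Subset n) v y → delete R v y v ≡ R v ─′ y
  delete-self R v y with v Fin.≟ v
  ... | yes _  = refl
  ... | no v≢v = contradiction refl v≢v

  ∈-delete : ∀ (R : Fin m → Subset n) v y {u w} → w ∈ R u → ¬ (u ≡ v × w ≡ y) → w ∈ delete R v y u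
  ∈-delete R v y {u} {w} w∈Ru avoid with u Fin.≟ v
  ... | yes u≡v = Subset.x∈p∧x≢y⇒x∈p-y w∈Ru λ w≡y → avoid (u≡v , w≡y)
  ... | no _    = w∈Ru

  -- Rado's exchange step: were both deletions to violate Hall's condition, at X₁ and X₂, then submodularity of
  -- X ↦ ∣ image R X ∣ would violate it at X₁ ∪ X₂ or at (X₁ ∩ X₂) ∖ v.
  delete-hall : ∀ (R : Fin m → Subset n) → Hall R → ∀ v {y₁ y₂} → y₁ ≢ y₂ →
    Hall (delete R v y₁) ⊎ Hall (delete R v y₂)
  delete-hall R hall v {y₁} {y₂} y₁≢y₂ with hall-or-violation (delete R v y₁) | hall-or-violation (delete R v y₂)
  ... | inj₁ hall₁ | _ = inj₁ hall₁
  ... | inj₂ _ | inj₁ hall₂ = inj₂ hall₂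
  ... | inj₂ (X₁ , lt₁) | inj₂ (X₂ , lt₂) = contradiction (begin-strict
      ∣ X₁ ∣ + ∣ X₂ ∣
        ≡⟨ ∣p∪q∣+∣p∩q∣ X₁ X₂ ⟨
      ∣ X₁ ∪ X₂ ∣ + ∣ X₁ ∩ X₂ ∣
        ≤⟨ +-monoʳ-≤ ∣ X₁ ∪ X₂ ∣ (∣p∣≤1+∣p-x∣ (X₁ ∩ X₂) v) ⟩
      -- Leaving out `v` costs one, while the two strict violations together gain two.
      ∣ X₁ ∪ X₂ ∣ + suc ∣ (X₁ ∩ X₂) ─′ v ∣
        ≤⟨ +-mono-≤ (≤-trans (hall (X₁ ∪ X₂)) (Subset.p⊆q⇒∣p∣≤∣q∣ ⊆-union))
                    (s≤s (≤-trans (hall ((X₁ ∩ X₂) ─′ v)) (Subset.p⊆q⇒∣p∣≤∣q∣ ⊆-intersection))) ⟩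
      ∣ P ∪ Q ∣ + suc ∣ P ∩ Q ∣
        ≡⟨ +-suc ∣ P ∪ Q ∣ ∣ P ∩ Q ∣ ⟩
      suc (∣ P ∪ Q ∣ + ∣ P ∩ Q ∣)
        ≡⟨ cong suc (∣p∪q∣+∣p∩q∣ P Q) ⟩
      suc ∣ P ∣ + ∣ Q ∣
        <⟨ +-mono-≤-< lt₁ lt₂ ⟩
      ∣ X₁ ∣ + ∣ X₂ ∣ ∎) (n≮n (∣ X₁ ∣ + ∣ X₂ ∣))
    where
    open ≤-Reasoning
    P = image (delete R v y₁) X₁
    Q = image (delete R v y₂) X₂

    -- The deletion changes `R` only at `v`, so a violator avoiding `v` would already violate Hall's
    -- condition for `R`.
    ∈-violator : ∀ {y X} → ∣ image (delete R v y) X ∣ < ∣ X ∣ → v ∈ X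
    ∈-violator {y} {X} lt with v Subset.∈? X
    ... | yes v∈X = v∈X
    ... | no  v∉X = contradiction (≤-trans (hall X) (Subset.p⊆q⇒∣p∣≤∣q∣ λ w∈ → keep (∈-image⁻ R w∈))) (<⇒≱ lt)
      where
      keep : ∀ {w} → ∃[ u ] u ∈ X × w ∈ R u → w ∈ image (delete R v y) X
      keep (u , u∈X , w∈Ru) = ∈-image⁺ (delete R v y) u∈X (∈-delete R v y w∈Ru λ where (refl , _) → v∉X u∈X)

    -- At `v`, every value other than `y₁` survives the first deletion, and `y₁` survives the second
    -- because `y₁ ≢ y₂`.
    ⊆-union : image R (X₁ ∪ X₂) ⊆ P ∪ Q
    ⊆-union {w} w∈ with ∈-image⁻ R w∈
    ... | u , u∈X₁∪X₂ , w∈Ru with u Fin.≟ v | w Fin.≟ y₁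
    ...   | yes refl | yes refl = Subset.q⊆p∪q P Q (∈-image⁺ (delete R v y₂) (∈-violator lt₂)
          (∈-delete R v y₂ w∈Ru (y₁≢y₂ ∘ proj₂)))
    ...   | yes refl | no w≢y₁  = Subset.p⊆p∪q Q (∈-image⁺ (delete R v y₁) (∈-violator lt₁)
          (∈-delete R v y₁ w∈Ru (w≢y₁ ∘ proj₂)))
    ...   | no u≢v   | _ with Subset.x∈p∪q⁻ X₁ X₂ u∈X₁∪X₂
    ...     | inj₁ u∈X₁ = Subset.p⊆p∪q Q (∈-image⁺ (delete R v y₁) u∈X₁ (∈-delete R v y₁ w∈Ru (u≢v ∘ proj₁)))
    ...     | inj₂ u∈X₂ = Subset.q⊆p∪q P Q (∈-image⁺ (delete R v y₂) u∈X₂ (∈-delete R v y₂ w∈Ru (u≢v ∘ proj₁)))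

    -- Away from `v` both deletions agree with `R`; at `v` each image may have lost a value, which
    -- is why `v` is left out.
    ⊆-intersection : image R ((X₁ ∩ X₂) ─′ v) ⊆ P ∩ Q
    ⊆-intersection {w} w∈ with ∈-image⁻ R w∈
    ... | u , u∈ , w∈Ru = Subset.x∈p∩q⁺
        ( ∈-image⁺ (delete R v y₁) (proj₁ u∈both) (∈-delete R v y₁ w∈Ru (u≢v ∘ proj₁))
        , ∈-image⁺ (delete R v y₂) (proj₂ u∈both) (∈-delete R v y₂ w∈Ru (u≢v ∘ proj₁)))
      where
      u∈both = Subset.x∈p∩q⁻ X₁ X₂ (Subset.p─q⊆p (X₁ ∩ X₂) ⁅ v ⁆ u∈)
      u≢v : u ≢ v
      u≢v refl = x∈p─q⇒x∉q (X₁ ∩ X₂) ⁅ v ⁆ u∈ (Subset.x∈⁅x⁆ v)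

  -- The termination measure for repeated deletion.
  total : (Fin m → Subset n) → ℕ
  total {zero}  R = 0
  total {suc m} R = ∣ R zero ∣ + total (R ∘ suc)

  total-mono-≤ : (R S : Fin m → Subset n) → (∀ u → ∣ R u ∣ ≤ ∣ S u ∣) → total R ≤ total S
  total-mono-≤ {zero}  R S R≤S = z≤n
  total-mono-≤ {suc m} R S R≤S = +-mono-≤ (R≤S zero) (total-mono-≤ (R ∘ suc) (S ∘ suc) (R≤S ∘ suc))

  total-mono-< : (R S : Fin m → Subset n) → (∀ u → ∣ R u ∣ ≤ ∣ S u ∣) → ∀ v → ∣ R v ∣ < ∣ S v ∣ → total R < total S
  total-mono-< R S R≤S zero    lt = +-mono-<-≤ lt (total-mono-≤ (R ∘ suc) (S ∘ suc) (R≤S ∘ suc))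
  total-mono-< R S R≤S (suc v) lt = +-mono-≤-< (R≤S zero) (total-mono-< (R ∘ suc) (S ∘ suc) (R≤S ∘ suc) v lt)

  delete-⊆ : ∀ (R : Fin m → Subset n) v y u → delete R v y u ⊆ R u
  delete-⊆ R v y u with u Fin.≟ v
  ... | yes _ = Subset.p─q⊆p (R u) ⁅ y ⁆
  ... | no _  = λ w∈ → w∈

  total-delete : ∀ (R : Fin m → Subset n) v {y} → y ∈ R v → total (delete R v y) < total R
  total-delete R v {y} y∈Rv = total-mono-< (delete R v y) R (λ u → Subset.p⊆q⇒∣p∣≤∣q∣ (delete-⊆ R v y u)) v
    (subst (λ p → ∣ p ∣ < ∣ R v ∣) (sym (delete-self R v y)) (Subset.x∈p⇒∣p-x∣<∣p∣ y∈Rv))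

  Injective : (Fin m → Fin n) → Set
  Injective σ = ∀ {u v} → σ u ≡ σ v → u ≡ v

  Transversal : (Fin m → Subset n) → Set
  Transversal {m} {n} R = ∃[ σ ] Injective σ × ∀ v → σ v ∈ R v

  -- Hall's condition at a singleton supplies the value. Two points sharing a value would form a
  -- pair whose image has one element only, against Hall's condition at that pair.
  functional-hall : ∀ (R : Fin m → Subset n) → Hall R → (∀ v {y z} → y ∈ R v → z ∈ R v → y ≡ z) → Transversal R
  functional-hall R hall functional = proj₁ ∘ choice , injective , proj₂ ∘ choice
    where
    choice : ∀ v → ∃[ w ] w ∈ R v
    choice v with 0<∣p∣⇒Nonempty (image R ⁅ v ⁆) (subst (_≤ ∣ image R ⁅ v ⁆ ∣) (Subset.∣⁅x⁆∣≡1 v) (hall ⁅ v ⁆))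
    ... | w , w∈ with ∈-image⁻ R w∈
    ...   | u , u∈⁅v⁆ , w∈Ru = w , subst (λ u → w ∈ R u) (Subset.x∈⁅y⁆⇒x≡y v u∈⁅v⁆) w∈Ru
    injective : Injective (proj₁ ∘ choice)
    injective {u} {v} eq with u Fin.≟ v
    ... | yes u≡v = u≡v
    ... | no  u≢v = contradiction (begin-strict
        ∣ ⁅ u ⁆ ∣                    <⟨ Subset.p⊂q⇒∣p∣<∣q∣
              (Subset.p⊆p∪q ⁅ v ⁆ , v , Subset.q⊆p∪q ⁅ u ⁆ ⁅ v ⁆ (Subset.x∈⁅x⁆ v) ,
                                        λ v∈⁅u⁆ → u≢v (sym (Subset.x∈⁅y⁆⇒x≡y u v∈⁅u⁆))) ⟩
        ∣ ⁅ u ⁆ ∪ ⁅ v ⁆ ∣            ≤⟨ hall (⁅ u ⁆ ∪ ⁅ v ⁆) ⟩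
        ∣ image R (⁅ u ⁆ ∪ ⁅ v ⁆) ∣  ≤⟨ Subset.p⊆q⇒∣p∣≤∣q∣ (λ w∈ → single (∈-image⁻ R w∈)) ⟩
        ∣ ⁅ proj₁ (choice u) ⁆ ∣     ≡⟨ trans (Subset.∣⁅x⁆∣≡1 (proj₁ (choice u))) (sym (Subset.∣⁅x⁆∣≡1 u)) ⟩
        ∣ ⁅ u ⁆ ∣                    ∎) (n≮n ∣ ⁅ u ⁆ ∣)
      where
      open ≤-Reasoning
      single : ∀ {w} → ∃[ t ] t ∈ ⁅ u ⁆ ∪ ⁅ v ⁆ × w ∈ R t → w ∈ ⁅ proj₁ (choice u) ⁆
      single {w} (t , t∈ , w∈Rt) = subst (w ∈_) (cong ⁅_⁆ w≡) (Subset.x∈⁅x⁆ w)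
        where
        w≡ : w ≡ proj₁ (choice u)
        w≡ with Subset.x∈p∪q⁻ ⁅ u ⁆ ⁅ v ⁆ t∈
        ... | inj₁ t∈⁅u⁆ = functional u (subst (λ t → w ∈ R t) (Subset.x∈⁅y⁆⇒x≡y u t∈⁅u⁆) w∈Rt) (proj₂ (choice u))
        ... | inj₂ t∈⁅v⁆ = trans (functional v (subst (λ t → w ∈ R t) (Subset.x∈⁅y⁆⇒x≡y v t∈⁅v⁆) w∈Rt)
              (proj₂ (choice v))) (sym eq)

  -- While some `R v` has two values, `delete-hall` removes one of them and keeps Hall's condition.
  -- What remains is functional, and its transversal serves for `R`, since deletion only shrinks
  -- sets.
  hall⇒transversal : ∀ (R : Fin m → Subset n) → Hall R → Transversal R
  hall⇒transversal R hall = go (total R) R ≤-refl hall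
    where
    weaken : ∀ {R : Fin m → Subset n} {v y} → Transversal (delete R v y) → Transversal R
    weaken {R = R} {v} {y} (σ , injective , σ∈) = σ , injective , λ u → delete-⊆ R v y u (σ∈ u)
    go : ∀ fuel (R : Fin m → Subset n) → total R ≤ fuel → Hall R → Transversal R
    go fuel R total≤fuel hall
      with Fin.any? (λ v → Fin.any? λ y → Fin.any? λ z → y Subset.∈? R v ×-dec z Subset.∈? R v ×-dec ¬? (y Fin.≟ z))
    ... | no ¬two = functional-hall R hall λ v {y} {z} y∈ z∈ → equal v y z y∈ z∈ (y Fin.≟ z)
      where
      equal : ∀ v y z → y ∈ R v → z ∈ R v → Dec (y ≡ z) → y ≡ z
      equal v y z y∈ z∈ (yes y≡z) = y≡z
      equal v y z y∈ z∈ (no y≢z)  = contradiction (v , y , z , y∈ , z∈ , y≢z) ¬two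
    go zero R total≤0 hall | yes (v , y , z , y∈ , _ , _) = contradiction
          (<-≤-trans (total-delete R v y∈) total≤0) λ ()
    go (suc fuel) R total≤ hall | yes (v , y , z , y∈ , z∈ , y≢z) with delete-hall R hall v y≢z
    ... | inj₁ hall₁ = weaken (go fuel (delete R v y) (m<1+n⇒m≤n (<-≤-trans (total-delete R v y∈) total≤)) hall₁)
    ... | inj₂ hall₂ = weaken (go fuel (delete R v z) (m<1+n⇒m≤n (<-≤-trans (total-delete R v z∈) total≤)) hall₂)

  -- Independent sets from violations of Hall's condition

  Independent : Graph n → Subset n → Set
  Independent G T = ∀ {u v} → u ∈ T → v ∈ T → adj G u v ≡ false

  violation⇒independent : ∀ (G : Graph n) {δ} → (∀ v → δ ≤ degree G v) →
    Violation (neighbours G) → ∃[ T ] Independent G T × δ < ∣ T ∣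
  violation⇒independent G {δ} δ≤deg (X , ∣N∣<∣X∣) = T , independent , large
        (0<∣p∣⇒Nonempty T (<-≤-trans (s≤s z≤n) ∣S∣<∣T∣))
    where
    N = image (neighbours G) X
    T = X ─ N
    S = N ─ X

    adjacent⇒∈N : ∀ {u v} → u ∈ X → adj G u v ≡ true → v ∈ N
    adjacent⇒∈N {u} u∈X uv = ∈-image⁺ (neighbours G) u∈X (∈-tabulate⁺ (adj G u) uv)

    independent : Independent G T
    independent {u} {v} u∈T v∈T with adj G u v in uv
    ... | false = refl
    ... | true  = contradiction (adjacent⇒∈N (Subset.p─q⊆p X N u∈T) uv) (x∈p─q⇒x∉q X N v∈T)

    ∣S∣<∣T∣ : ∣ S ∣ < ∣ T ∣
    ∣S∣<∣T∣ = +-cancelʳ-< (∣ X ∩ N ∣) _ _ (subst₂ _<_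
      (trans (sym (∣p─q∣+∣p∩q∣ N X)) (cong (λ p → ∣ S ∣ + ∣ p ∣) (Subset.∩-comm N X)))
      (sym (∣p─q∣+∣p∩q∣ X N)) ∣N∣<∣X∣)

    -- A neighbour of `t` is in `N` because `t` is in `X`; were it in `X` too, then `t` would be in
    -- `N`.
    neighbours⊆S : ∀ {t} → t ∈ T → neighbours G t ⊆ S
    neighbours⊆S {t} t∈T {w} w∈ = Subset.x∈p∧x∉q⇒x∈p─q (adjacent⇒∈N (Subset.p─q⊆p X N t∈T) tw) λ w∈X →
      x∈p─q⇒x∉q X N t∈T (adjacent⇒∈N w∈X (trans (symmetric G w t) tw))
      where
      tw : adj G t w ≡ true
      tw = ∈-tabulate⁻ (adj G t) w∈

    -- The minimum degree enters through a vertex of `T`; one exists because `T` is strictly larger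
    -- than `S`.
    large : Nonempty T → δ < ∣ T ∣
    large (t , t∈T) = ≤-<-trans (≤-trans (δ≤deg t) (Subset.p⊆q⇒∣p∣≤∣q∣ (neighbours⊆S t∈T))) ∣S∣<∣T∣

module SpectralBound where

  open import Data.Rational.Base
  open import Data.Rational.Properties
  open SemiringSum (CommutativeRing.semiring +-*-commutativeRing)
    using (sum-cong-≗; sum-replicate-zero; ∑-distrib-+; *-distribˡ-sum; *-distribʳ-sum; ∑-comm)
    renaming (sum to ∑)
  open HallTheorem using (Injective; Independent)

  private variable
    n : ℕ

  -- Rational inequalities

  ring : AlmostCommutativeRing _ _
  ring = fromCommutativeRing +-*-commutativeRing λ x → dec⇒maybe (0ℚ ≟ x)

  +-nonneg : ∀ {p q} → 0ℚ ≤ p → 0ℚ ≤ q → 0ℚ ≤ p + q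
  +-nonneg = +-mono-≤

  *-nonneg : ∀ {p q} → 0ℚ ≤ p → 0ℚ ≤ q → 0ℚ ≤ p * q
  *-nonneg {p} {q} 0≤p 0≤q =
    nonNegative⁻¹ _ {{nonNeg*nonNeg⇒nonNeg p {{nonNegative 0≤p}} q {{nonNegative 0≤q}}}}

  *-pos : ∀ {p q} → 0ℚ < p → 0ℚ < q → 0ℚ < p * q
  *-pos {p} {q} 0<p 0<q =
    positive⁻¹ _ {{pos*pos⇒pos p {{positive 0<p}} q {{positive 0<q}}}}

  sq-nonneg : ∀ p → 0ℚ ≤ p * p
  sq-nonneg p with ≤-total 0ℚ p
  ... | inj₁ 0≤p = *-nonneg 0≤p 0≤p
  ... | inj₂ p≤0 = subst (0ℚ ≤_) (lemma p) (*-nonneg (neg-antimono-≤ p≤0) (neg-antimono-≤ p≤0))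
    where
    lemma : ∀ p → (- p) * (- p) ≡ p * p
    lemma = solve-∀ ring

  -- Splits an inequality into the sign of an explicit slack `r` and an identity for the ring
  -- solver. The long slack terms further on are written for this purpose.
  ≤-from-diff : ∀ {p q} r → 0ℚ ≤ r → q ≡ p + r → p ≤ q
  ≤-from-diff {p} {q} r 0≤r q≡p+r = begin
    p       ≡⟨ +-identityʳ p ⟨
    p + 0ℚ  ≤⟨ +-monoʳ-≤ p 0≤r ⟩
    p + r   ≡⟨ q≡p+r ⟨
    q       ∎
    where open ≤-Reasoning

  <-from-diff : ∀ {p q} r → 0ℚ < r → q ≡ p + r → p < q
  <-from-diff {p} {q} r 0<r q≡p+r = begin-strict
    p       ≡⟨ +-identityʳ p ⟨
    p + 0ℚ  <⟨ +-monoʳ-< p 0<r ⟩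
    p + r   ≡⟨ q≡p+r ⟨
    q       ∎
    where open ≤-Reasoning

  diff-nonneg : ∀ {p q} → p ≤ q → 0ℚ ≤ q - p
  diff-nonneg {p} {q} p≤q = subst (_≤ q - p) (+-inverseʳ p) (+-monoˡ-≤ (- p) p≤q)

  diff-pos : ∀ {p q} → p < q → 0ℚ < q - p
  diff-pos {p} {q} p<q = subst (_< q - p) (+-inverseʳ p) (+-monoˡ-< (- p) p<q)

  *-cancel-nonneg : ∀ {p q} → 0ℚ < p → 0ℚ ≤ p * q → 0ℚ ≤ q
  *-cancel-nonneg {p} {q} 0<p 0≤pq =
    *-cancelˡ-≤-pos p {{positive 0<p}} (subst (_≤ p * q) (sym (*-zeroʳ p)) 0≤pq)

  *-monoˡ : ∀ {p q r} → 0ℚ ≤ r → p ≤ q → r * p ≤ r * q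
  *-monoˡ {r = r} 0≤r = *-monoˡ-≤-nonNeg r {{nonNegative 0≤r}}

  *-monoʳ : ∀ {p q r} → 0ℚ ≤ r → p ≤ q → p * r ≤ q * r
  *-monoʳ {r = r} 0≤r = *-monoʳ-≤-nonNeg r {{nonNegative 0≤r}}

  p≤∣p∣ : ∀ p → p ≤ ∣ p ∣
  p≤∣p∣ p with ≤-total 0ℚ p
  ... | inj₁ 0≤p = ≤-reflexive (sym (0≤p⇒∣p∣≡p 0≤p))
  ... | inj₂ p≤0 = ≤-trans p≤0 (0≤∣p∣ p)

  -p≤∣p∣ : ∀ p → - p ≤ ∣ p ∣
  -p≤∣p∣ p = subst (- p ≤_) (∣-p∣≡∣p∣ p) (p≤∣p∣ (- p))

  -- Rational quadratic forms

  QMatrix : ℕ → Set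
  QMatrix n = Fin n → Fin n → ℚ

  ∑-nonneg : (f : Vector ℚ n) → (∀ i → 0ℚ ≤ f i) → 0ℚ ≤ ∑ f
  ∑-nonneg {zero}  f h = ≤-refl
  ∑-nonneg {suc n} f h = +-nonneg (h zero) (∑-nonneg (f ∘ suc) (h ∘ suc))

  ∑-mono : {f g : Vector ℚ n} → (∀ i → f i ≤ g i) → ∑ f ≤ ∑ g
  ∑-mono {zero}  h = ≤-refl
  ∑-mono {suc n} h = +-mono-≤ (h zero) (∑-mono (h ∘ suc))

  ∑-zero : (f : Vector ℚ n) → (∀ i → f i ≡ 0ℚ) → ∑ f ≡ 0ℚ
  ∑-zero {n} f h = trans (sum-cong-≗ {n} h) (sum-replicate-zero n)

  -- The rational number n, written as a sum so that it combines with the other sums.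
  κ : ℕ → ℚ
  κ n = ∑ {n} λ _ → 1ℚ

  κ-nonneg : ∀ n → 0ℚ ≤ κ n
  κ-nonneg n = ∑-nonneg {n} (λ _ → 1ℚ) λ _ → nonNegative⁻¹ 1ℚ

  infixl 7 _∙_

  _∙_ : Vector ℚ n → Vector ℚ n → ℚ
  x ∙ y = ∑ λ i → x i * y i

  quad : QMatrix n → Vector ℚ n → ℚ
  quad N x = x ∙ λ i → N i ∙ x

  PSD : QMatrix n → Set
  PSD N = ∀ x → 0ℚ ≤ quad N x

  Symm : QMatrix n → Set
  Symm N = ∀ i j → N i j ≡ N j i

  row₀ : QMatrix (suc n) → Vector ℚ n
  row₀ N j = N zero (suc j)

  minor : QMatrix (suc n) → QMatrix n
  minor N i j = N (suc i) (suc j)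

  -- The Schur complement of the corner entry, multiplied by that entry so that no division is needed.
  schur : QMatrix (suc n) → QMatrix n
  schur N i j = N zero zero * minor N i j + (- 1ℚ) * (row₀ N i * row₀ N j)

  ∙-comm : (x y : Vector ℚ n) → x ∙ y ≡ y ∙ x
  ∙-comm {n} x y = sum-cong-≗ {n} λ i → *-comm (x i) (y i)

  ∙-scaleʳ : ∀ c (x y : Vector ℚ n) → (x ∙ λ i → c * y i) ≡ c * (x ∙ y)
  ∙-scaleʳ {n} c x y = trans (sum-cong-≗ {n} λ i → lemma c (x i) (y i)) (sym (*-distribˡ-sum {n} c _))
    where
    lemma : ∀ c x y → x * (c * y) ≡ c * (x * y)
    lemma = solve-∀ ring

  ∙-distribˡ-+ : ∀ (x y z : Vector ℚ n) → (x ∙ λ i → y i + z i) ≡ x ∙ y + x ∙ z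
  ∙-distribˡ-+ {n} x y z = trans (sum-cong-≗ {n} λ i → *-distribˡ-+ (x i) (y i) (z i)) (∑-distrib-+ {n} _ _)

  ∙-linearˡ : ∀ c d (x y z : Vector ℚ n) → (λ i → c * x i + d * y i) ∙ z ≡ c * (x ∙ z) + d * (y ∙ z)
  ∙-linearˡ c d x y z = begin
    (λ i → c * x i + d * y i) ∙ z             ≡⟨ ∙-comm _ z ⟩
    (z ∙ λ i → c * x i + d * y i)             ≡⟨ ∙-distribˡ-+ z _ _ ⟩
    (z ∙ λ i → c * x i) + (z ∙ λ i → d * y i) ≡⟨ cong₂ _+_ (∙-scaleʳ c z x) (∙-scaleʳ d z y) ⟩
    c * (z ∙ x) + d * (z ∙ y)                 ≡⟨ cong₂ (λ s t → c * s + d * t) (∙-comm z x) (∙-comm z y) ⟩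
    c * (x ∙ z) + d * (y ∙ z)                 ∎
    where open ≡-Reasoning

  quad-linear : ∀ c d (A B : QMatrix n) x →
    quad (λ i j → c * A i j + d * B i j) x ≡ c * quad A x + d * quad B x
  quad-linear {n} c d A B x = begin
    (x ∙ λ i → (λ j → c * A i j + d * B i j) ∙ x)           ≡⟨ sum-cong-≗ {n}
          (λ i → cong (x i *_) (∙-linearˡ c d (A i) (B i) x)) ⟩
    (x ∙ λ i → c * (A i ∙ x) + d * (B i ∙ x))               ≡⟨ ∙-distribˡ-+ x _ _ ⟩
    (x ∙ λ i → c * (A i ∙ x)) + (x ∙ λ i → d * (B i ∙ x))   ≡⟨ cong₂ _+_ (∙-scaleʳ c x _) (∙-scaleʳ d x _) ⟩
    c * quad A x + d * quad B x                             ∎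
    where open ≡-Reasoning

  quad-outer : ∀ (b x : Vector ℚ n) → quad (λ i j → b i * b j) x ≡ (b ∙ x) * (b ∙ x)
  quad-outer {n} b x = begin
    (x ∙ λ i → (λ j → b i * b j) ∙ x)  ≡⟨ sum-cong-≗ {n}
          (λ i → cong (x i *_) (trans (sum-cong-≗ {n} λ j → *-assoc (b i) (b j) (x j))
          (sym (*-distribˡ-sum {n} (b i) _)))) ⟩
    (x ∙ λ i → b i * (b ∙ x))          ≡⟨ sum-cong-≗ {n} (λ i → lemma (x i) (b i) (b ∙ x)) ⟩
    (∑ λ i → b i * x i * (b ∙ x))      ≡⟨ *-distribʳ-sum {n} (b ∙ x) _ ⟨
    (b ∙ x) * (b ∙ x)                  ∎
    where
    open ≡-Reasoning
    lemma : ∀ x b s → x * (b * s) ≡ b * x * s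
    lemma = solve-∀ ring

  quad-scale : ∀ (N : QMatrix n) c x → quad N (λ i → c * x i) ≡ c * c * quad N x
  quad-scale {n} N c x = begin
    ((λ i → c * x i) ∙ λ i → N i ∙ λ j → c * x j)  ≡⟨ sum-cong-≗ {n}
          (λ i → trans (cong (c * x i *_) (∙-scaleʳ c (N i) x)) (lemma c (x i) (N i ∙ x))) ⟩
    (∑ λ i → c * c * (x i * (N i ∙ x)))            ≡⟨ *-distribˡ-sum {n} (c * c) _ ⟨
    c * c * quad N x                               ∎
    where
    open ≡-Reasoning
    lemma : ∀ c x s → c * x * (c * s) ≡ c * c * (x * s)
    lemma = solve-∀ ring

  quad-schur : ∀ (N : QMatrix (suc n)) y →
    quad (schur N) y ≡ N zero zero * quad (minor N) y - (row₀ N ∙ y) * (row₀ N ∙ y)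
  quad-schur N y = trans (quad-linear (N zero zero) (- 1ℚ) (minor N) (λ i j → row₀ N i * row₀ N j) y)
    (trans (cong (λ t → N zero zero * quad (minor N) y + (- 1ℚ) * t) (quad-outer (row₀ N) y))
           (lemma (N zero zero * quad (minor N) y) ((row₀ N ∙ y) * (row₀ N ∙ y))))
    where
    lemma : ∀ p t → p + (- 1ℚ) * t ≡ p - t
    lemma = solve-∀ ring

  quad-suc : ∀ (N : QMatrix (suc n)) → Symm N → ∀ t y →
    quad N (t Vector.∷ y) ≡ N zero zero * t * t + (t * (row₀ N ∙ y) + t * (row₀ N ∙ y)) + quad (minor N) y
  quad-suc {n} N sym-N t y = begin
    t * (α * t + b ∙ y) + (y ∙ λ i → N (suc i) zero * t + minor N i ∙ y)
      ≡⟨ cong (t * (α * t + b ∙ y) +_) (∙-distribˡ-+ y (λ i → N (suc i) zero * t) _) ⟩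
    t * (α * t + b ∙ y) + ((y ∙ λ i → N (suc i) zero * t) + quad (minor N) y)
      ≡⟨ cong (λ s → t * (α * t + b ∙ y) + (s + quad (minor N) y))
           (trans (sum-cong-≗ {n} λ i → trans (cong (λ s → y i * (s * t)) (sym-N (suc i) zero))
                 (lemma₁ (y i) (b i) t))
                  (sym (*-distribˡ-sum {n} t _))) ⟩
    t * (α * t + b ∙ y) + (t * (b ∙ y) + quad (minor N) y)
      ≡⟨ lemma₂ t α (b ∙ y) _ ⟩
    α * t * t + (t * (b ∙ y) + t * (b ∙ y)) + quad (minor N) y ∎
    where
    open ≡-Reasoning
    α = N zero zero
    b = row₀ N
    lemma₁ : ∀ y b t → y * (b * t) ≡ t * (b * y)
    lemma₁ = solve-∀ ring
    lemma₂ : ∀ t α s q → t * (α * t + s) + (t * s + q) ≡ α * t * t + (t * s + t * s) + q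
    lemma₂ = solve-∀ ring

  quad-cons : ∀ (N : QMatrix (suc n)) → Symm N → ∀ x →
    let t = x zero; y = x ∘ suc in
    quad N x ≡ N zero zero * t * t + (t * (row₀ N ∙ y) + t * (row₀ N ∙ y)) + quad (minor N) y
  quad-cons N sym-N x = quad-suc N sym-N (x zero) (x ∘ suc)

  -- The usual completion of the square, multiplied by the corner entry; it holds whatever the sign
  -- of that entry.
  complete-square : ∀ (N : QMatrix (suc n)) → Symm N → ∀ x →
    let u = N zero zero * x zero + row₀ N ∙ (x ∘ suc) in
    N zero zero * quad N x ≡ u * u + quad (schur N) (x ∘ suc)
  complete-square N sym-N x = begin
    α * quad N x
      ≡⟨ cong (α *_) (quad-cons N sym-N x) ⟩
    α * (α * t * t + (t * s + t * s) + quad (minor N) y)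
      ≡⟨ lemma α t s (quad (minor N) y) ⟩
    (α * t + s) * (α * t + s) + (α * quad (minor N) y - s * s)
      ≡⟨ cong ((α * t + s) * (α * t + s) +_) (quad-schur N y) ⟨
    (α * t + s) * (α * t + s) + quad (schur N) y ∎
    where
    open ≡-Reasoning
    α = N zero zero
    t = x zero
    y = x ∘ suc
    s = row₀ N ∙ y
    lemma : ∀ α t s q → α * (α * t * t + (t * s + t * s) + q) ≡ (α * t + s) * (α * t + s) + (α * q - s * s)
    lemma = solve-∀ ring

  schur-symm : ∀ (N : QMatrix (suc n)) → Symm N → Symm (schur N)
  schur-symm N sym-N i j = cong₂ (λ p q → N zero zero * p + (- 1ℚ) * q)
    (sym-N (suc i) (suc j)) (*-comm (row₀ N i) (row₀ N j))

  schur-PSD : ∀ (N : QMatrix (suc n)) → Symm N → 0ℚ < N zero zero → PSD N → PSD (schur N)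
  schur-PSD N sym-N 0<α psd y = *-cancel-nonneg 0<α (subst (0ℚ ≤_) eq (psd x))
    where
    open ≡-Reasoning
    α = N zero zero
    b = row₀ N
    -- Chosen to make the square of `complete-square` vanish: α (- b ∙ y) + b ∙ (α y) = 0.
    x = (- (b ∙ y)) Vector.∷ (λ i → α * y i)
    lemma : ∀ α s q → α * (- s) * (- s) + ((- s) * (α * s) + (- s) * (α * s)) + α * α * q ≡ α * (α * q - s * s)
    lemma = solve-∀ ring
    eq : quad N x ≡ α * quad (schur N) y
    eq = begin
      quad N x
        ≡⟨ quad-suc N sym-N _ _ ⟩
      _ ≡⟨ cong₂ (λ p q → α * (- (b ∙ y)) * (- (b ∙ y)) + ((- (b ∙ y)) * p + (- (b ∙ y)) * p) + q)
             (∙-scaleʳ α b y) (quad-scale (minor N) α y) ⟩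
      _ ≡⟨ lemma α (b ∙ y) (quad (minor N) y) ⟩
      α * (α * quad (minor N) y - (b ∙ y) * (b ∙ y))
        ≡⟨ cong (α *_) (quad-schur N y) ⟨
      α * quad (schur N) y ∎

  I : Fin n → Fin n → ℚ
  I i j = if does (i Fin.≟ j) then 1ℚ else 0ℚ

  I-suc : ∀ (i j : Fin n) → I (suc i) (suc j) ≡ I i j
  I-suc i j with i Fin.≟ j
  ... | yes refl = refl
  ... | no _ = refl

  ∙-I : ∀ (x : Vector ℚ n) i → I i ∙ x ≡ x i
  ∙-I x zero    = trans (cong₂ _+_ (*-identityˡ (x zero))
        (∑-zero (λ j → 0ℚ * x (suc j)) λ j → *-zeroˡ (x (suc j)))) (+-identityʳ (x zero))
  ∙-I {suc n} x (suc i) = trans (cong₂ _+_ (*-zeroˡ (x zero))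
    (trans (sum-cong-≗ {n} λ j → cong (_* x (suc j)) (I-suc i j)) (∙-I (x ∘ suc) i))) (+-identityˡ _)

  I-∙ : ∀ (x : Vector ℚ n) i → x ∙ I i ≡ x i
  I-∙ x i = trans (∙-comm x (I i)) (∙-I x i)

  quad-I : (x : Vector ℚ n) → quad I x ≡ x ∙ x
  quad-I {n} x = sum-cong-≗ {n} λ i → cong (x i *_) (∙-I x i)

  quad-axis : ∀ (N : QMatrix n) i s → quad N (λ j → s * I i j) ≡ s * s * N i i
  quad-axis N i s = begin
    quad N (λ j → s * I i j)            ≡⟨ quad-scale N s (I i) ⟩
    s * s * (I i ∙ λ j → N j ∙ I i)     ≡⟨ cong (s * s *_) (∙-I _ i) ⟩
    s * s * (N i ∙ I i)                 ≡⟨ cong (s * s *_) (I-∙ (N i) i) ⟩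
    s * s * N i i                       ∎
    where open ≡-Reasoning

  quad-corner-axis : ∀ (N : QMatrix (suc n)) → Symm N → ∀ t i s →
    quad N (t Vector.∷ λ j → s * I i j) ≡
    N zero zero * t * t + (t * (s * row₀ N i) + t * (s * row₀ N i)) + s * s * N (suc i) (suc i)
  quad-corner-axis N sym-N t i s = trans (quad-suc N sym-N t _)
    (cong₂ (λ p q → N zero zero * t * t + (t * p + t * p) + q)
      (trans (∙-scaleʳ s (row₀ N) (I i)) (cong (s *_) (I-∙ (row₀ N) i)))
      (quad-axis (minor N) i s))

  PSD⇒corner-nonneg : ∀ (N : QMatrix (suc n)) → PSD N → 0ℚ ≤ N zero zero
  PSD⇒corner-nonneg N psd = subst (0ℚ ≤_) (trans (quad-axis N zero 1ℚ) (*-identityˡ _)) (psd (λ j → 1ℚ * I zero j))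

  sq-pos : ∀ {p} → p ≢ 0ℚ → 0ℚ < p * p
  sq-pos {p} p≢0 with <-cmp 0ℚ p
  ... | tri< 0<p _ _ = *-pos 0<p 0<p
  ... | tri≈ _ 0≡p _ = contradiction (sym 0≡p) p≢0
  ... | tri> _ _ p<0 = subst (0ℚ <_) (lemma p) (*-pos (neg-antimono-< p<0) (neg-antimono-< p<0))
    where
    lemma : ∀ p → (- p) * (- p) ≡ p * p
    lemma = solve-∀ ring

  zero-corner-PSD⇒zero-row : ∀ (N : QMatrix (suc n)) → Symm N → N zero zero ≡ 0ℚ → PSD N →
    ∀ i → row₀ N i ≡ 0ℚ
  zero-corner-PSD⇒zero-row N sym-N α≡0 psd i with row₀ N i ≟ 0ℚ
  ... | yes b≡0 = b≡0
  ... | no  b≢0 = contradiction (psd (t Vector.∷ λ j → b * I i j))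
        (<⇒≱ (subst (_< 0ℚ) (sym eq) (neg-antimono-< (sq-pos b≢0))))
    where
    open ≡-Reasoning
    <⇒≱ : ∀ {p q} → p < q → ¬ (q ≤ p)
    <⇒≱ p<q q≤p = <-irrefl refl (<-≤-trans p<q q≤p)
    b = row₀ N i
    c = N (suc i) (suc i)
    -- With zero corner the form at (t, b eᵢ) is b² (2 t + c), and this `t` makes the factor equal
    -- to -1.
    t = - (½ * (c + 1ℚ))
    lemma : ∀ b c → let t = - (½ * (c + 1ℚ)) in
      0ℚ * t * t + (t * (b * b) + t * (b * b)) + b * b * c ≡ - (b * b)
    lemma = solve-∀ ring
    eq : quad N (t Vector.∷ λ j → b * I i j) ≡ - (b * b)
    eq = trans (quad-corner-axis N sym-N t i b)
      (trans (cong (λ α → α * t * t + (t * (b * b) + t * (b * b)) + b * b * c) α≡0) (lemma b c))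

  -- Recursion on the dimension, by the sign of the corner. A positive corner passes to the Schur
  -- complement and a negative one refutes. A zero corner forces the rest of its row to vanish,
  -- after which only the minor matters.
  PSD? : (N : QMatrix n) → Symm N → Dec (PSD N)
  PSD? {zero}  N sym-N = yes λ _ → ≤-refl
  PSD? {suc n} N sym-N with <-cmp 0ℚ (N zero zero)
  ... | tri> _ _ α<0 = no λ psd → <-irrefl refl (<-≤-trans α<0 (PSD⇒corner-nonneg N psd))
  ... | tri< 0<α _ _ = map′
    (λ psd x → *-cancel-nonneg 0<α (subst (0ℚ ≤_) (sym (complete-square N sym-N x))
      (+-nonneg (sq-nonneg (N zero zero * x zero + row₀ N ∙ (x ∘ suc))) (psd (x ∘ suc)))))
    (schur-PSD N sym-N 0<α)
    (PSD? (schur N) (schur-symm N sym-N))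
  ... | tri≈ _ 0≡α _ with Fin.all? (λ i → row₀ N i ≟ 0ℚ)
  ...   | no ¬all-0 = no λ psd → ¬all-0 (zero-corner-PSD⇒zero-row N sym-N (sym 0≡α) psd)
  ...   | yes all-0 = map′
    (λ psd x → subst (0ℚ ≤_) (sym (eq x)) (psd (x ∘ suc)))
    (λ psd y → subst (0ℚ ≤_) (eq (0ℚ Vector.∷ y)) (psd (0ℚ Vector.∷ y)))
    (PSD? (minor N) λ i j → sym-N (suc i) (suc j))
    where
    lemma : ∀ t q → 0ℚ * t * t + (t * 0ℚ + t * 0ℚ) + q ≡ q
    lemma = solve-∀ ring
    eq : ∀ x → quad N x ≡ quad (minor N) (x ∘ suc)
    eq x = trans (quad-cons N sym-N x) (trans
      (cong₂ (λ α s → α * x zero * x zero + (x zero * s + x zero * s) + quad (minor N) (x ∘ suc))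
        (sym 0≡α) (∑-zero (λ i → row₀ N i * x (suc i)) λ i → trans (cong (_* x (suc i)) (all-0 i))
              (*-zeroˡ (x (suc i)))))
      (lemma (x zero) _))

  -- The matrix q I - M, spelled as a linear combination to fit `quad-linear` and to agree
  -- definitionally with the approximations of `top-matrix`.
  shift : ℚ → QMatrix n → QMatrix n
  shift q M i j = (- 1ℚ) * M i j + q * I i j

  quad-shift : ∀ q (M : QMatrix n) x → quad (shift q M) x ≡ q * (x ∙ x) - quad M x
  quad-shift q M x = trans (quad-linear (- 1ℚ) q M I x)
    (trans (cong (λ t → (- 1ℚ) * quad M x + q * t) (quad-I x)) (lemma q (x ∙ x) (quad M x)))
    where
    lemma : ∀ q s t → (- 1ℚ) * t + q * s ≡ q * s - t
    lemma = solve-∀ ring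

  I-symm : (i j : Fin n) → I i j ≡ I j i
  I-symm i j with i Fin.≟ j | j Fin.≟ i
  ... | yes _   | yes _  = refl
  ... | no _    | no _   = refl
  ... | yes i≡j | no j≢i = contradiction (sym i≡j) j≢i
  ... | no i≢j  | yes j≡i = contradiction (sym j≡i) i≢j

  shift-symm : ∀ q {M : QMatrix n} → Symm M → Symm (shift q M)
  shift-symm q sym-M i j = cong₂ (λ p r → (- 1ℚ) * p + q * r) (sym-M i j) (I-symm i j)

  -- From 2 x y ≤ x² + y².
  quad-bound : ∀ η (M : QMatrix n) → 0ℚ ≤ η → (∀ i j → ∣ M i j ∣ ≤ η) → ∀ x →
    quad M x ≤ η * (κ n * (x ∙ x))
  quad-bound {n} η M 0≤η M≤η x = begin
    quad M x
      ≡⟨ sum-cong-≗ {n} (λ i → *-distribˡ-sum {n} (x i) λ j → M i j * x j) ⟩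
    (∑ λ i → ∑ λ j → x i * (M i j * x j))
      ≤⟨ ∑-mono (λ i → ∑-mono λ j → entry (x i) (x j) (M≤η i j)) ⟩
    (∑ λ i → ∑ λ j → ½ * η * (x i * x i) * 1ℚ + ½ * η * (x j * x j))
      ≡⟨ sum-cong-≗ {n} (λ i → trans (∑-distrib-+ {n} (λ _ → ½ * η * (x i * x i) * 1ℚ) (λ j → ½ * η * (x j * x j)))
           (cong₂ _+_ (sym (*-distribˡ-sum {n} (½ * η * (x i * x i)) (λ _ → 1ℚ)))
                      (sym (*-distribˡ-sum {n} (½ * η) (λ j → x j * x j))))) ⟩
    (∑ λ i → ½ * η * (x i * x i) * m + ½ * η * (x ∙ x))
      ≡⟨ sum-cong-≗ {n} (λ i → lemma (½ * η) (x i * x i) m (x ∙ x)) ⟩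
    (∑ λ i → ½ * η * m * (x i * x i) + ½ * η * (x ∙ x) * 1ℚ)
      ≡⟨ trans (∑-distrib-+ {n} (λ i → ½ * η * m * (x i * x i)) (λ _ → ½ * η * (x ∙ x) * 1ℚ))
           (cong₂ _+_ (sym (*-distribˡ-sum {n} (½ * η * m) (λ i → x i * x i)))
                      (sym (*-distribˡ-sum {n} (½ * η * (x ∙ x)) (λ _ → 1ℚ)))) ⟩
    ½ * η * m * (x ∙ x) + ½ * η * (x ∙ x) * m
      ≡⟨ lemma₂ η m (x ∙ x) ⟩
    η * (m * (x ∙ x)) ∎
    where
    open ≤-Reasoning
    m : ℚ
    m = κ n
    lemma : ∀ h s m q → h * s * m + h * q ≡ h * m * s + h * q * 1ℚ
    lemma = solve-∀ ring
    lemma₂ : ∀ η m s → ½ * η * m * s + ½ * η * s * m ≡ η * (m * s)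
    lemma₂ = solve-∀ ring
    lemma₃ : ∀ η e a b → ½ * η * (a * a) * 1ℚ + ½ * η * (b * b) ≡
      a * (e * b) + (½ * ½ * (η - e) * ((a + b) * (a + b)) + ½ * ½ * (η + e) * ((a - b) * (a - b)))
    lemma₃ = solve-∀ ring
    entry : ∀ a b {e} → ∣ e ∣ ≤ η → a * (e * b) ≤ ½ * η * (a * a) * 1ℚ + ½ * η * (b * b)
    entry a b {e} e≤η = ≤-from-diff _
      (+-nonneg
        (*-nonneg (*-nonneg (nonNegative⁻¹ (½ * ½)) (diff-nonneg (≤-trans (p≤∣p∣ e) e≤η))) (sq-nonneg (a + b)))
        (*-nonneg (*-nonneg (nonNegative⁻¹ (½ * ½)) 0≤η+e) (sq-nonneg (a - b))))
      (lemma₃ η e a b)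
      where
      0≤η+e : 0ℚ ≤ η + e
      0≤η+e = subst (λ p → 0ℚ ≤ η + p) (lemma₄ e) (diff-nonneg (≤-trans (-p≤∣p∣ e) e≤η))
        where
        lemma₄ : ∀ e → - (- e) ≡ e
        lemma₄ = solve-∀ ring

  -- Real matrices as sequences of rational ones

  divide : ∀ {p q} → 0ℚ < p → 0ℚ < q → ∃[ r ] 0ℚ < r × p * r ≡ q
  divide {p} {q} 0<p 0<q = r , *-pos (positive⁻¹ p⁻¹ {{1/pos⇒pos p {{positive 0<p}}}}) 0<q , (begin
    p * (p⁻¹ * q)  ≡⟨ *-assoc p p⁻¹ q ⟨
    (p * p⁻¹) * q  ≡⟨ cong (_* q) (*-inverseʳ p {{p≢0}}) ⟩
    1ℚ * q         ≡⟨ *-identityˡ q ⟩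
    q              ∎)
    where
    open ≡-Reasoning
    p≢0 = pos⇒nonZero p {{positive 0<p}}
    p⁻¹ = 1/_ p {{p≢0}}
    r = p⁻¹ * q

  ∣p∣<q : ∀ {p q} → p < q → - p < q → ∣ p ∣ < q
  ∣p∣<q {p} p<q -p<q with ∣p∣≡p∨∣p∣≡-p p
  ... | inj₁ eq = subst (_< _) (sym eq) p<q
  ... | inj₂ eq = subst (_< _) (sym eq) -p<q

  Eventually : (ℕ → Set) → Set
  Eventually P = ∃[ K ] ∀ k → K ℕ.≤ k → P k

  eventually-map : ∀ {P Q : ℕ → Set} → (∀ {k} → P k → Q k) → Eventually P → Eventually Q
  eventually-map f (K , h) = K , λ k K≤k → f (h k K≤k)

  eventually-× : ∀ {P Q : ℕ → Set} → Eventually P → Eventually Q → Eventually (λ k → P k × Q k)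
  eventually-× (K , h) (L , g) = K ℕ.⊔ L , λ k K⊔L≤k →
    h k (ℕ.m⊔n≤o⇒m≤o K L K⊔L≤k) , g k (ℕ.m⊔n≤o⇒n≤o K L K⊔L≤k)

  eventually-∀ : ∀ {P : Fin n → ℕ → Set} → (∀ i → Eventually (P i)) → Eventually (λ k → ∀ i → P i k)
  eventually-∀ {zero}  h = 0 , λ _ _ ()
  eventually-∀ {suc n} h = eventually-map (λ where (p , _) zero → p ; (_ , ps) (suc i) → ps i)
    (eventually-× (h zero) (eventually-∀ (h ∘ suc)))

  eventually-∃ : ∀ {P : ℕ → Set} → Eventually P → ∃[ k ] P k
  eventually-∃ (K , h) = K , h K ℕ.≤-refl

  Null : (ℕ → ℚ) → Set
  Null f = ∀ ε → 0ℚ < ε → Eventually λ k → ∣ f k ∣ < ε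

  Null-≗ : ∀ {f g} → f ≗ g → Null f → Null g
  Null-≗ f≗g null ε 0<ε = eventually-map (λ {k} → subst (λ p → ∣ p ∣ < ε) (f≗g k)) (null ε 0<ε)

  ≈0⇒Null : ∀ x → x ≈ℝ 0ℝ → Null (seq x)
  ≈0⇒Null x = Null-≗ λ k → +-identityʳ (seq x k)

  0<½ : 0ℚ < ½
  0<½ = positive⁻¹ ½

  0<1 : 0ℚ < 1ℚ
  0<1 = positive⁻¹ 1ℚ

  bounded : ∀ x → ∃[ B ] 0ℚ < B × Eventually λ k → ∣ seq x k ∣ ≤ B
  bounded x with cauchy x 1ℚ 0<1
  ... | K , h = ∣ seq x K ∣ + 1ℚ , +-mono-≤-< (0≤∣p∣ (seq x K)) 0<1 , K , λ k K≤k → begin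
    ∣ seq x k ∣                            ≡⟨ cong ∣_∣ (lemma (seq x k) (seq x K)) ⟩
    ∣ seq x K + (seq x k - seq x K) ∣      ≤⟨ ∣p+q∣≤∣p∣+∣q∣ (seq x K) _ ⟩
    ∣ seq x K ∣ + ∣ seq x k - seq x K ∣    ≤⟨ +-monoʳ-≤ ∣ seq x K ∣ (<⇒≤ (h k K K≤k ℕ.≤-refl)) ⟩
    ∣ seq x K ∣ + 1ℚ                       ∎
    where
    open ≤-Reasoning
    lemma : ∀ p q → p ≡ q + (p - q)
    lemma = solve-∀ ring

  p≤p+q : ∀ p {q} → 0ℚ < q → p ≤ p + q
  p≤p+q p {q} 0<q = ≤-from-diff {p} {p + q} q (<⇒≤ 0<q) refl

  q≤p+q : ∀ {p} q → 0ℚ < p → q ≤ p + q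
  q≤p+q {p} q 0<p = ≤-from-diff {q} {p + q} p (<⇒≤ 0<p) (+-comm p q)

  -- Abstract in the notion of bound, so that one argument passes from entries to vectors and from
  -- vectors to matrices.
  bounded-family : {X : Set} {∥_∥≤_at_ : X → ℚ → ℕ → Set} →
    (∀ {x B C k} → B ≤ C → ∥ x ∥≤ B at k → ∥ x ∥≤ C at k) →
    (∀ x → ∃[ B ] 0ℚ < B × Eventually ∥ x ∥≤ B at_) →
    ∀ {n} (x : Fin n → X) → ∃[ B ] 0ℚ < B × Eventually λ k → ∀ i → ∥ x i ∥≤ B at k
  bounded-family weaken bound {zero}  x = 1ℚ , 0<1 , 0 , λ _ _ ()
  bounded-family {∥_∥≤_at_ = ∥_∥≤_at_} weaken bound {suc n} x =
    combine (bound (x zero)) (bounded-family {∥_∥≤_at_ = ∥_∥≤_at_} weaken bound (x ∘ suc))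
    where
    combine : (∃[ B ] 0ℚ < B × Eventually ∥ x zero ∥≤ B at_) →
      (∃[ C ] 0ℚ < C × Eventually λ k → ∀ i → ∥ x (suc i) ∥≤ C at k) →
      ∃[ B ] 0ℚ < B × Eventually λ k → ∀ i → ∥ x i ∥≤ B at k
    combine (B , 0<B , h) (C , 0<C , g) = B + C , +-mono-< 0<B 0<C ,
      eventually-map step (eventually-× h g)
      where
      step : ∀ {k} → (∥ x zero ∥≤ B at k) × (∀ i → ∥ x (suc i) ∥≤ C at k) → ∀ i → ∥ x i ∥≤ B + C at k
      step (p , _)  zero    = weaken (p≤p+q B 0<C) p
      step (_ , ps) (suc i) = weaken (q≤p+q C 0<B) (ps i)

  bounded-vector : (x : Vector ℝ n) → ∃[ B ] 0ℚ < B × Eventually λ k → ∀ i → ∣ seq (x i) k ∣ ≤ B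
  bounded-vector = bounded-family {∥_∥≤_at_ = λ x B k → ∣ seq x k ∣ ≤ B} (λ B≤C x≤B → ≤-trans x≤B B≤C) bounded

  bounded-matrix : (M : Matrix n) →
    ∃[ B ] 0ℚ < B × Eventually λ k → ∀ i j → ∣ seq (M i j) k ∣ ≤ B
  bounded-matrix = bounded-family {∥_∥≤_at_ = λ x B k → ∀ j → ∣ seq (x j) k ∣ ≤ B}
    (λ B≤C x≤B j → ≤-trans (x≤B j) B≤C) bounded-vector

  -- For each `ε` the modulus names an index `m` after which `α` moves by less than ¼ε, and there
  -- the rational comparison with ½ε is decidable. A value of at least ½ε would keep `α` above ¼ε
  -- from then on, hence apart from zero; a smaller one keeps it below `ε`.
  ¬apart⇒Null : ∀ α → Eventually (λ k → 0ℚ ≤ seq α k) →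
    ¬ (∃[ D ] 0ℚ < D × Eventually λ k → 1ℚ ≤ D * seq α k) → Null (seq α)
  ¬apart⇒Null α (K , 0≤α) ¬apart ε 0<ε with cauchy α (½ * (½ * ε)) (*-pos 0<½ (*-pos 0<½ 0<ε))
  ... | L , h = K ℕ.⊔ L , small (½ * ε ≤? seq α m)
    where
    open ≤-Reasoning
    m = K ℕ.⊔ L
    η = ½ * (½ * ε)
    0<η : 0ℚ < η
    0<η = *-pos 0<½ (*-pos 0<½ 0<ε)
    close : ∀ k → m ℕ.≤ k → ∣ seq α k - seq α m ∣ < η
    close k m≤k = h k m (ℕ.m⊔n≤o⇒n≤o K L m≤k) (ℕ.m≤n⊔m K L)
    lemma₁ : ∀ ε p q → ε ≡ p + (½ * (½ * ε) + (½ * (½ * ε) - (p - q)) + (½ * ε - q))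
    lemma₁ = solve-∀ ring
    lemma₂ : ∀ ε p q → p ≡ ½ * (½ * ε) + ((½ * (½ * ε) - - (p - q)) + (q - ½ * ε))
    lemma₂ = solve-∀ ring
    large : ½ * ε ≤ seq α m → (∃[ D ] 0ℚ < D × η * D ≡ 1ℚ) → ∃[ D ] 0ℚ < D × Eventually λ k → 1ℚ ≤ D * seq α k
    large ½ε≤α (D , 0<D , ηD≡1) = D , 0<D , m , λ k m≤k → begin
      1ℚ           ≡⟨ ηD≡1 ⟨
      η * D        ≡⟨ *-comm η D ⟩
      D * η        ≤⟨ *-monoˡ (<⇒≤ 0<D) (≤-from-diff (η - - (seq α k - seq α m) + (seq α m - ½ * ε))
                        (+-nonneg (<⇒≤ (diff-pos (≤-<-trans (-p≤∣p∣ (seq α k - seq α m)) (close k m≤k))))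
                              (diff-nonneg ½ε≤α))
                        (lemma₂ ε (seq α k) (seq α m))) ⟩
      D * seq α k  ∎
    small : Dec (½ * ε ≤ seq α m) → ∀ k → m ℕ.≤ k → ∣ seq α k ∣ < ε
    small (no ½ε≰α) k m≤k = subst (_< ε) (sym (0≤p⇒∣p∣≡p (0≤α k (ℕ.m⊔n≤o⇒m≤o K L m≤k))))
      (<-from-diff (η + (η - (seq α k - seq α m)) + (½ * ε - seq α m))
        (+-mono-< (+-mono-< 0<η (diff-pos (≤-<-trans (p≤∣p∣ (seq α k - seq α m)) (close k m≤k))))
              (diff-pos (≰⇒> ½ε≰α)))
        (lemma₁ ε (seq α k) (seq α m)))
    small (yes ½ε≤α) = contradiction (large ½ε≤α (divide 0<η 0<1)) ¬apart

  -- Whether a nonnegative real is zero or apart from it cannot be decided constructively; under a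
  -- double negation it can.
  null-or-apart : ∀ α → Eventually (λ k → 0ℚ ≤ seq α k) →
    ¬ ¬ (Null (seq α) ⊎ ∃[ D ] 0ℚ < D × Eventually λ k → 1ℚ ≤ D * seq α k)
  null-or-apart α 0≤α ¬either = ¬either (inj₁ (¬apart⇒Null α 0≤α (¬either ∘ inj₂)))

  Null-cancel : ∀ {f g : ℕ → ℚ} {D} → 0ℚ < D → Eventually (λ k → 1ℚ ≤ D * f k) →
    Null (λ k → f k * g k) → Null g
  Null-cancel {f} {g} {D} 0<D 1≤Df null ε 0<ε with divide 0<D 0<ε
  ... | η , 0<η , Dη≡ε = eventually-map bound (eventually-× 1≤Df (null η 0<η))
    where
    open ≤-Reasoning
    bound : ∀ {k} → 1ℚ ≤ D * f k × ∣ f k * g k ∣ < η → ∣ g k ∣ < ε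
    bound {k} (1≤Dfk , fg<η) = begin-strict
      ∣ g k ∣                  ≡⟨ *-identityˡ _ ⟨
      1ℚ * ∣ g k ∣             ≤⟨ *-monoʳ (0≤∣p∣ (g k)) 1≤Dfk ⟩
      D * f k * ∣ g k ∣        ≤⟨ *-monoʳ (0≤∣p∣ (g k)) (*-monoˡ (<⇒≤ 0<D) (p≤∣p∣ (f k))) ⟩
      D * ∣ f k ∣ * ∣ g k ∣    ≡⟨ *-assoc D _ _ ⟩
      D * (∣ f k ∣ * ∣ g k ∣)  ≡⟨ cong (D *_) (∣p*q∣≡∣p∣*∣q∣ (f k) (g k)) ⟨
      D * ∣ f k * g k ∣        <⟨ *-monoʳ-<-pos D {{positive 0<D}} fg<η ⟩
      D * η                    ≡⟨ Dη≡ε ⟩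
      ε                        ∎

  at : Matrix n → ℕ → QMatrix n
  at M k i j = seq (M i j) k

  atᵛ : Vector ℝ n → ℕ → Vector ℚ n
  atᵛ x k i = seq (x i) k

  seq-sum : ∀ (f : Vector ℝ n) k → seq (sum f) k ≡ ∑ λ i → seq (f i) k
  seq-sum {zero}  f k = refl
  seq-sum {suc n} f k = cong (seq (f zero) k +_) (seq-sum (f ∘ suc) k)

  seq-· : ∀ (M : Matrix n) x i k → seq ((M · x) i) k ≡ at M k i ∙ atᵛ x k
  seq-· M x i k = seq-sum (λ j → M i j *ℝ x j) k

  -- Limits of positive semidefinite forms: singular or coercive

  Singular : Matrix n → Set
  Singular N = ∃[ x ] ¬ (∀ i → Null (seq (x i))) × ∀ i → Null λ k → at N k i ∙ atᵛ x k

  -- Positive definiteness with a lower bound 1/L that is uniform in the stage `k` as well as in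
  -- `x`.
  Coercive : Matrix n → Set
  Coercive N = ∃[ L ] 0ℚ < L × Eventually λ k → ∀ x → x ∙ x ≤ L * quad (at N k) x

  -- Evaluation at t = T and t = -T gives 2 T ∣b∣ ≤ α T² + C. Both terms on the right are at most ½ε
  -- T, so ∣b∣ ≤ ½ε.
  quadratic-bound : ∀ {α b C B T ε} → 0ℚ < T → 0ℚ < ε → ½ * ε * T ≡ B →
    (∀ t → 0ℚ ≤ α * t * t + (t * b + t * b) + C) → C ≤ B → T * α ≤ ½ * ε → ∣ b ∣ < ε
  quadratic-bound {α} {b} {C} {B} {T} {ε} 0<T 0<ε ½εT≡B nonneg C≤B Tα≤½ε = ∣p∣<q
    (conclude b (subst (0ℚ ≤_) (sym (lemma⁺ α b C T ε)) (sum-nonneg (- T))))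
    (conclude (- b) (subst (0ℚ ≤_) (sym (lemma⁻ α b C T ε)) (sum-nonneg T)))
    where
    lemma⁺ : ∀ α b C T ε → (T + T) * (½ * ε - b) ≡
      α * (- T) * (- T) + ((- T) * b + (- T) * b) + C + (½ * ε * T - C) + T * (½ * ε - T * α)
    lemma⁺ = solve-∀ ring
    lemma⁻ : ∀ α b C T ε → (T + T) * (½ * ε - (- b)) ≡
      α * T * T + (T * b + T * b) + C + (½ * ε * T - C) + T * (½ * ε - T * α)
    lemma⁻ = solve-∀ ring
    lemma : ∀ b ε → ε ≡ b + (½ * ε + (½ * ε - b))
    lemma = solve-∀ ring
    sum-nonneg : ∀ t → 0ℚ ≤ α * t * t + (t * b + t * b) + C + (½ * ε * T - C) + T * (½ * ε - T * α)
    sum-nonneg t = +-nonneg (+-nonneg (nonneg t) (diff-nonneg (≤-trans C≤B (≤-reflexive (sym ½εT≡B)))))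
      (*-nonneg (<⇒≤ 0<T) (diff-nonneg Tα≤½ε))
    conclude : ∀ b → 0ℚ ≤ (T + T) * (½ * ε - b) → b < ε
    conclude b h = <-from-diff (½ * ε + (½ * ε - b))
      (+-mono-<-≤ (*-pos 0<½ 0<ε) (*-cancel-nonneg (+-mono-< 0<T 0<T) h)) (lemma b ε)

  -- The corners only tend to zero, so `zero-corner-PSD⇒zero-row` has to become an estimate: `T` is
  -- fixed first, large enough to absorb the bound on the diagonal entry, and then `k` is taken so
  -- late that `T` times the corner is below ½ε.
  zero-corner⇒zero-row : (N : Matrix (suc n)) → (∀ k → Symm (at N k)) → Eventually (PSD ∘ at N) →
    Null (seq (N zero zero)) → ∀ i → Null (seq (N zero (suc i)))
  zero-corner⇒zero-row N sym-N psd null i ε 0<ε =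
    let B , 0<B , C≤B   = bounded (N (suc i) (suc i))
        T , 0<T , ½εT≡B = divide (*-pos 0<½ 0<ε) 0<B
        η , 0<η , Tη≡½ε = divide 0<T (*-pos 0<½ 0<ε)
    in eventually-map
      (λ {k} (psd , C≤B , α<η) → quadratic-bound 0<T 0<ε ½εT≡B (nonneg k psd) (≤-trans (p≤∣p∣ _) C≤B)
        (≤-trans (*-monoˡ (<⇒≤ 0<T) (≤-trans (p≤∣p∣ _) (<⇒≤ α<η))) (≤-reflexive Tη≡½ε)))
      (eventually-× psd (eventually-× C≤B (null η 0<η)))
    where
    lemma : ∀ α b C t → α * t * t + (t * (1ℚ * b) + t * (1ℚ * b)) + 1ℚ * 1ℚ * C ≡ α * t * t + (t * b + t * b) + C
    lemma = solve-∀ ring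
    nonneg : ∀ k → PSD (at N k) → ∀ t → let b = seq (N zero (suc i)) k in
      0ℚ ≤ seq (N zero zero) k * t * t + (t * b + t * b) + seq (N (suc i) (suc i)) k
    nonneg k psd t = subst (0ℚ ≤_)
      (trans (quad-corner-axis (at N k) (sym-N k) t i 1ℚ)
            (lemma (seq (N zero zero) k) (seq (N zero (suc i)) k) (seq (N (suc i) (suc i)) k) t))
      (psd (t Vector.∷ λ j → 1ℚ * I i j))

  -- A crude Cauchy-Schwarz inequality: (b ∙ y)² is the form of the rank-one matrix b bᵀ, whose
  -- entries are at most B².
  dot-bound : ∀ {B} (b : Vector ℚ n) → 0ℚ ≤ B → (∀ i → ∣ b i ∣ ≤ B) → ∀ y →
    (b ∙ y) * (b ∙ y) ≤ B * B * (κ n * (y ∙ y))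
  dot-bound {n} {B} b 0≤B b≤B y = subst (_≤ B * B * (κ n * (y ∙ y))) (quad-outer b y)
    (quad-bound (B * B) (λ i j → b i * b j) (*-nonneg 0≤B 0≤B)
      (λ i j → begin
        ∣ b i * b j ∣      ≡⟨ ∣p*q∣≡∣p∣*∣q∣ (b i) (b j) ⟩
        ∣ b i ∣ * ∣ b j ∣  ≤⟨ *-monoʳ (0≤∣p∣ (b j)) (b≤B i) ⟩
        B * ∣ b j ∣        ≤⟨ *-monoˡ 0≤B (b≤B j) ⟩
        B * B              ∎) y)
    where open ≤-Reasoning

  ∙-nonneg : (x : Vector ℚ n) → 0ℚ ≤ x ∙ x
  ∙-nonneg x = ∑-nonneg (λ i → x i * x i) λ i → sq-nonneg (x i)

  -- The two summands bound, in units of the corner times the form, the squared first coordinate and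
  -- the squared length of the rest, as estimated in `schur-coercive⇒coercive`.
  coercivity : ℕ → ℚ → ℚ → ℚ → ℚ
  coercivity n B D L = D * D * (1ℚ + 1ℚ + (1ℚ + 1ℚ) * (B * B * κ n * L)) + L

  coercivity-pos : ∀ n {B} D {L} → 0ℚ ≤ B → 0ℚ < L → 0ℚ < coercivity n B D L
  coercivity-pos n D 0≤B 0<L = +-mono-≤-< (*-nonneg (sq-nonneg D) (+-nonneg 0≤2 (*-nonneg 0≤2
      (*-nonneg (*-nonneg (*-nonneg 0≤B 0≤B) (κ-nonneg n)) (<⇒≤ 0<L))))) 0<L
    where
    0≤2 : 0ℚ ≤ 1ℚ + 1ℚ
    0≤2 = nonNegative⁻¹ (1ℚ + 1ℚ)

  -- In `complete-square` both u² and the Schur form are at most E. Coercivity of the latter bounds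
  -- y ∙ y by L E. Then (α t)² = (u - s)² ≤ 2 u² + 2 s², where `dot-bound` controls s², and 1 ≤ D α
  -- turns this into a bound on t².
  schur-coercive⇒coercive : ∀ (N : QMatrix (suc n)) → Symm N → ∀ {A B D L} →
    0ℚ < D → 0ℚ < L → 0ℚ ≤ B →
    1ℚ ≤ D * N zero zero → ∣ N zero zero ∣ ≤ A → (∀ i → ∣ row₀ N i ∣ ≤ B) →
    (∀ y → y ∙ y ≤ L * quad (schur N) y) →
    ∀ x → x ∙ x ≤ coercivity n B D L * A * quad N x
  schur-coercive⇒coercive {n} N sym-N {A} {B} {D} {L} 0<D 0<L 0≤B 1≤Dα α≤A b≤B coercive x = begin
    t * t + Y
      ≤⟨ +-mono-≤ tt≤ Y≤LE ⟩
    D * D * ((1ℚ + 1ℚ) * E + (1ℚ + 1ℚ) * (β * (L * E))) + L * E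
      ≡⟨ lemma₁ D β L E ⟩
    G * E
      ≡⟨ *-assoc G α Q ⟨
    G * α * Q
      ≤⟨ *-monoʳ 0≤Q (*-monoˡ 0≤G (≤-trans (p≤∣p∣ α) α≤A)) ⟩
    G * A * Q ∎
    where
    open ≤-Reasoning
    α = N zero zero
    t = x zero
    y = x ∘ suc
    Y = y ∙ y
    s = row₀ N ∙ y
    u = α * t + s
    Q = quad N x
    E = α * Q
    σ = quad (schur N) y
    m : ℚ
    m = κ n
    β = B * B * m
    G = coercivity n B D L
    0≤2 : 0ℚ ≤ 1ℚ + 1ℚ
    0≤2 = nonNegative⁻¹ (1ℚ + 1ℚ)
    0≤β : 0ℚ ≤ β
    0≤β = *-nonneg (*-nonneg 0≤B 0≤B) (κ-nonneg n)
    0≤G : 0ℚ ≤ G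
    0≤G = <⇒≤ (coercivity-pos n D 0≤B 0<L)
    E≡ : E ≡ u * u + σ
    E≡ = complete-square N sym-N x
    0≤σ : 0ℚ ≤ σ
    0≤σ = *-cancel-nonneg 0<L (≤-trans (∙-nonneg y) (coercive y))
    uu≤E : u * u ≤ E
    uu≤E = ≤-from-diff σ 0≤σ E≡
    σ≤E : σ ≤ E
    σ≤E = ≤-from-diff (u * u) (sq-nonneg u) (trans E≡ (+-comm (u * u) σ))
    Y≤LE : Y ≤ L * E
    Y≤LE = ≤-trans (coercive y) (*-monoˡ (<⇒≤ 0<L) σ≤E)
    0≤Q : 0ℚ ≤ Q
    0≤Q = *-cancel-nonneg (<-≤-trans 0<1 1≤Dα) (subst (0ℚ ≤_) (sym (*-assoc D α Q))
      (*-nonneg (<⇒≤ 0<D) (≤-trans (sq-nonneg u) uu≤E)))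
    ss≤ : s * s ≤ β * (L * E)
    ss≤ = begin
      s * s              ≤⟨ dot-bound (row₀ N) 0≤B b≤B y ⟩
      B * B * (m * Y)    ≡⟨ *-assoc (B * B) m Y ⟨
      β * Y              ≤⟨ *-monoˡ 0≤β Y≤LE ⟩
      β * (L * E)        ∎
    lemma₁ : ∀ D β L E → D * D * ((1ℚ + 1ℚ) * E + (1ℚ + 1ℚ) * (β * (L * E))) + L * E ≡
      (D * D * (1ℚ + 1ℚ + (1ℚ + 1ℚ) * (β * L)) + L) * E
    lemma₁ = solve-∀ ring
    lemma₂ : ∀ α t s → let u = α * t + s in
      (1ℚ + 1ℚ) * (u * u) + (1ℚ + 1ℚ) * (s * s) ≡ α * α * (t * t) + (u + s) * (u + s)
    lemma₂ = solve-∀ ring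
    lemma₃ : ∀ D α t → D * D * (α * α * (t * t)) ≡ t * t + ((D * α - 1ℚ) * (D * α + 1ℚ)) * (t * t)
    lemma₃ = solve-∀ ring
    tt≤ : t * t ≤ D * D * ((1ℚ + 1ℚ) * E + (1ℚ + 1ℚ) * (β * (L * E)))
    tt≤ = begin
      t * t
        ≤⟨ ≤-from-diff _ (*-nonneg (*-nonneg (diff-nonneg 1≤Dα)
              (+-nonneg (≤-trans (<⇒≤ 0<1) 1≤Dα) (<⇒≤ 0<1))) (sq-nonneg t)) (lemma₃ D α t) ⟩
      D * D * (α * α * (t * t))
        ≤⟨ *-monoˡ (sq-nonneg D) (≤-from-diff ((u + s) * (u + s)) (sq-nonneg (u + s)) (lemma₂ α t s)) ⟩
      D * D * ((1ℚ + 1ℚ) * (u * u) + (1ℚ + 1ℚ) * (s * s))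
        ≤⟨ *-monoˡ (sq-nonneg D) (+-mono-≤ (*-monoˡ 0≤2 uu≤E) (*-monoˡ 0≤2 ss≤)) ⟩
      D * D * ((1ℚ + 1ℚ) * E + (1ℚ + 1ℚ) * (β * (L * E))) ∎

  -- At each stage `k` this is definitionally `schur (at N k)`, so the rational lemmas apply without
  -- transport.
  schurℝ : Matrix (suc n) → Matrix n
  schurℝ N i j = N zero zero *ℝ N (suc i) (suc j) +ℝ fromℚ (- 1ℚ) *ℝ (N zero (suc i) *ℝ N zero (suc j))

  schur-row : ∀ (N : QMatrix (suc n)) i y →
    schur N i ∙ y ≡ N zero zero * (minor N i ∙ y) + (- 1ℚ) * (row₀ N i * (row₀ N ∙ y))
  schur-row {n} N i y = trans (∙-linearˡ (N zero zero) (- 1ℚ) (minor N i) (λ j → row₀ N i * row₀ N j) y)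
    (cong (λ s → N zero zero * (minor N i ∙ y) + (- 1ℚ) * s)
      (trans (sum-cong-≗ {n} λ j → *-assoc (row₀ N i) (row₀ N j) (y j))
             (sym (*-distribˡ-sum {n} (row₀ N i) λ j → row₀ N j * y j))))

  -- A kernel vector `y` of the Schur complement lifts to (- b ∙ y, α y): the first row cancels
  -- identically and each other row becomes the matching row of the Schur complement. The lift is
  -- nonzero because α, being apart from zero, can be cancelled.
  schur-singular⇒singular : (N : Matrix (suc n)) → (∀ k → Symm (at N k)) → ∀ {D} → 0ℚ < D →
    Eventually (λ k → 1ℚ ≤ D * seq (N zero zero) k) → Singular (schurℝ N) → Singular N
  schur-singular⇒singular {n} N sym-N 0<D 1≤Dα (y , y≉0 , Sy≈0) =
    x , (λ x≈0 → y≉0 λ i → Null-cancel 0<D 1≤Dα (x≈0 (suc i))) , Nx≈0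
    where
    open ≡-Reasoning
    x : Vector ℝ (suc n)
    x zero    = fromℚ (- 1ℚ) *ℝ sum λ i → N zero (suc i) *ℝ y i
    x (suc i) = N zero zero *ℝ y i
    row : ∀ i k → at N k i ∙ atᵛ x k ≡
      seq (N i zero) k * ((- 1ℚ) * (row₀ (at N k) ∙ atᵛ y k)) + seq (N zero zero) k * ((at N k i ∘ suc) ∙ atᵛ y k)
    row i k = cong₂ (λ p q → seq (N i zero) k * ((- 1ℚ) * p) + q)
      (seq-sum (λ i → N zero (suc i) *ℝ y i) k) (∙-scaleʳ (seq (N zero zero) k) (at N k i ∘ suc) (atᵛ y k))
    lemma₀ : ∀ α s → 0ℚ ≡ α * ((- 1ℚ) * s) + α * s
    lemma₀ = solve-∀ ring
    lemma₁ : ∀ α b s r → α * r + (- 1ℚ) * (b * s) ≡ b * ((- 1ℚ) * s) + α * r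
    lemma₁ = solve-∀ ring
    Nx≈0 : ∀ i → Null λ k → at N k i ∙ atᵛ x k
    Nx≈0 zero = Null-≗ {f = λ _ → 0ℚ} (λ k → trans (lemma₀ (seq (N zero zero) k) (row₀ (at N k) ∙ atᵛ y k))
          (sym (row zero k)))
      λ ε 0<ε → 0 , λ _ _ → 0<ε
    Nx≈0 (suc i) = Null-≗ (λ k → begin
      schur (at N k) i ∙ atᵛ y k
        ≡⟨ schur-row (at N k) i (atᵛ y k) ⟩
      _ ≡⟨ lemma₁ (seq (N zero zero) k) (seq (N zero (suc i)) k) (row₀ (at N k) ∙ atᵛ y k)
            (minor (at N k) i ∙ atᵛ y k) ⟩
      seq (N zero (suc i)) k * ((- 1ℚ) * (row₀ (at N k) ∙ atᵛ y k)) +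
        seq (N zero zero) k * (minor (at N k) i ∙ atᵛ y k)
        ≡⟨ cong (λ b → b * ((- 1ℚ) * (row₀ (at N k) ∙ atᵛ y k)) +
                   seq (N zero zero) k * (minor (at N k) i ∙ atᵛ y k)) (sym-N k zero (suc i)) ⟩
      _ ≡⟨ row (suc i) k ⟨
      at N k (suc i) ∙ atᵛ x k ∎) (Sy≈0 i)

  -- The first column tends to zero entry by entry, so the first basis vector is in the kernel.
  zero-corner⇒singular : (N : Matrix (suc n)) → (∀ k → Symm (at N k)) → Eventually (PSD ∘ at N) →
    Null (seq (N zero zero)) → Singular N
  zero-corner⇒singular N sym-N psd null = (λ i → fromℚ (I zero i)) , e≉0 , λ i →
    Null-≗ (λ k → sym (I-∙ (at N k i) zero)) (col i)
    where
    e≉0 : ¬ (∀ i → Null λ _ → I zero i)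
    e≉0 e≈0 with e≈0 zero 1ℚ 0<1
    ... | K , h = <-irrefl refl (h K ℕ.≤-refl)
    col : ∀ i → Null (seq (N i zero))
    col zero    = null
    col (suc i) = Null-≗ (λ k → sym-N k zero (suc i)) (zero-corner⇒zero-row N sym-N psd null i)

  -- The recursion of `PSD?` carried to the limit, with `null-or-apart` in place of the sign test. A
  -- null corner is singular at once; otherwise either outcome for the Schur complement lifts back.
  singular-or-coercive : (N : Matrix n) → (∀ k → Symm (at N k)) → Eventually (PSD ∘ at N) →
    ¬ ¬ (Singular N ⊎ Coercive N)
  singular-or-coercive {zero}  N sym-N psd ¬either = ¬either (inj₂ (1ℚ , 0<1 , 0 , λ _ _ _ → ≤-refl))
  singular-or-coercive {suc n} N sym-N psd ¬either =
    null-or-apart (N zero zero) (eventually-map (λ {k} → PSD⇒corner-nonneg (at N k)) psd) λ where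
      (inj₁ null) → ¬either (inj₁ (zero-corner⇒singular N sym-N psd null))
      (inj₂ (D , 0<D , 1≤Dα)) → singular-or-coercive (schurℝ N)
        (λ k → schur-symm (at N k) (sym-N k))
        (eventually-map (λ {k} (psd , 1≤Dα) → schur-PSD (at N k) (sym-N k) (corner-pos 0<D 1≤Dα) psd)
          (eventually-× psd 1≤Dα)) λ where
        (inj₁ singular) → ¬either (inj₁ (schur-singular⇒singular N sym-N 0<D 1≤Dα singular))
        (inj₂ (L , 0<L , coercive)) → ¬either (inj₂ (go 0<D 1≤Dα 0<L coercive))
    where
    corner-pos : ∀ {D α} → 0ℚ < D → 1ℚ ≤ D * α → 0ℚ < α
    corner-pos {D} {α} 0<D 1≤Dα = *-cancelˡ-<-nonNeg D {{pos⇒nonNeg D {{positive 0<D}}}}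
      (subst (_< D * α) (sym (*-zeroʳ D)) (<-≤-trans 0<1 1≤Dα))
    go : ∀ {D L} → 0ℚ < D → Eventually (λ k → 1ℚ ≤ D * seq (N zero zero) k) → 0ℚ < L →
      Eventually (λ k → ∀ y → y ∙ y ≤ L * quad (schur (at N k)) y) → Coercive N
    go {D} {L} 0<D 1≤Dα 0<L coercive = combine (bounded (N zero zero)) (bounded-vector (λ j → N zero (suc j)))
      where
      combine : (∃[ A ] 0ℚ < A × Eventually λ k → ∣ seq (N zero zero) k ∣ ≤ A) →
        (∃[ B ] 0ℚ < B × Eventually λ k → ∀ j → ∣ seq (N zero (suc j)) k ∣ ≤ B) → Coercive N
      combine (A , 0<A , α≤A) (B , 0<B , b≤B) =
        coercivity n B D L * A , *-pos (coercivity-pos n D (<⇒≤ 0<B) 0<L) 0<A ,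
        eventually-map step (eventually-× (eventually-× 1≤Dα α≤A) (eventually-× b≤B coercive))
        where
        step : ∀ {k} → (1ℚ ≤ D * seq (N zero zero) k × ∣ seq (N zero zero) k ∣ ≤ A) ×
                       (∀ j → ∣ seq (N zero (suc j)) k ∣ ≤ B) ×
                       (∀ y → y ∙ y ≤ L * quad (schur (at N k)) y) →
               ∀ x → x ∙ x ≤ coercivity n B D L * A * quad (at N k) x
        step {k} ((1≤Dα , α≤A) , b≤B , coercive) =
          schur-coercive⇒coercive (at N k) (sym-N k) 0<D 0<L (<⇒≤ 0<B) 1≤Dα α≤A b≤B coercive

  -- Construction of an eigenvalue

  /1-suc : ∀ m → ℤ.+ suc m / 1 ≡ 1ℚ + ℤ.+ m / 1
  /1-suc m = toℚᵘ-injective (begin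
    toℚᵘ (ℤ.+ suc m / 1)                          ≈⟨ toℚᵘ-fromℚᵘ (ℚᵘ.mkℚᵘ (ℤ.+ suc m) 0) ⟩
    ℚᵘ.mkℚᵘ (ℤ.+ suc m) 0                         ≈⟨ ℚᵘ.*≡* (cong (ℤ._* ℤ.+ 1)
          (cong (λ i → ℤ.+ 1 ℤ.+ i) (sym (ℤ.*-identityʳ (ℤ.+ m))))) ⟩
    ℚᵘ.mkℚᵘ (ℤ.+ 1) 0 ℚᵘ.+ ℚᵘ.mkℚᵘ (ℤ.+ m) 0        ≈⟨ ℚᵘ.+-congʳ (ℚᵘ.mkℚᵘ (ℤ.+ 1) 0)
          (ℚᵘ.≃-sym (toℚᵘ-fromℚᵘ (ℚᵘ.mkℚᵘ (ℤ.+ m) 0))) ⟩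
    toℚᵘ 1ℚ ℚᵘ.+ toℚᵘ (ℤ.+ m / 1)                 ≈⟨ ℚᵘ.≃-sym (toℚᵘ-homo-+ 1ℚ (ℤ.+ m / 1)) ⟩
    toℚᵘ (1ℚ + ℤ.+ m / 1)                         ∎)
    where open ℚᵘ.≃-Reasoning

  κ≡/1 : ∀ m → κ m ≡ ℤ.+ m / 1
  κ≡/1 zero    = refl
  κ≡/1 (suc m) = trans (cong (λ p → 1ℚ + p) (κ≡/1 m)) (sym (/1-suc m))

  archimedean : ∀ p → ∃[ m ] p ≤ κ m
  archimedean p@(mkℚ i d-1 _) = ℤ.∣ i ∣ , subst (p ≤_) (sym (κ≡/1 ℤ.∣ i ∣)) (toℚᵘ-cancel-≤ (begin
    ℚᵘ.mkℚᵘ i d-1              ≤⟨ ℚᵘ.*≤* (bound i) ⟩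
    ℚᵘ.mkℚᵘ (ℤ.+ ℤ.∣ i ∣) 0      ≃⟨ ℚᵘ.≃-sym (toℚᵘ-fromℚᵘ (ℚᵘ.mkℚᵘ (ℤ.+ ℤ.∣ i ∣) 0)) ⟩
    toℚᵘ (ℤ.+ ℤ.∣ i ∣ / 1)       ∎))
    where
    open ℚᵘ.≤-Reasoning
    bound : ∀ i → i ℤ.* ℤ.+ 1 ℤ.≤ ℤ.+ ℤ.∣ i ∣ ℤ.* ℤ.+ suc d-1
    bound (ℤ.+ m)       = subst₂ ℤ._≤_ (ℤ.pos-* m 1) (ℤ.pos-* m (suc d-1)) (ℤ.+≤+ (ℕ.*-monoʳ-≤ m (ℕ.s≤s ℕ.z≤n)))
    bound ℤ.-[1+ m ] = ℤ.-≤+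

  κ-mono : ∀ {l m} → l ℕ.≤ m → κ l ≤ κ m
  κ-mono {m = m} ℕ.z≤n = κ-nonneg m
  κ-mono (ℕ.s≤s l≤m) = +-monoʳ-≤ 1ℚ (κ-mono l≤m)

  κ-pos : ∀ m → 0ℚ < κ (suc m)
  κ-pos m = +-mono-<-≤ 0<1 (κ-nonneg m)

  abstract
    unit-fraction : ∀ k → ∃[ h ] 0ℚ < h × κ (suc k) * h ≡ 1ℚ
    unit-fraction k = divide (κ-pos k) 0<1

  mesh : ℕ → ℚ
  mesh k = proj₁ (unit-fraction k)

  mesh-pos : ∀ k → 0ℚ < mesh k
  mesh-pos k = proj₁ (proj₂ (unit-fraction k))

  mesh-small : ∀ ε → 0ℚ < ε → Eventually λ k → mesh k < ε
  mesh-small ε 0<ε = go (divide 0<ε 0<1)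
    where
    open ≤-Reasoning
    go : (∃[ r ] 0ℚ < r × ε * r ≡ 1ℚ) → Eventually λ k → mesh k < ε
    go (r , 0<r , εr≡1) = bound (archimedean r)
      where
      bound : (∃[ m ] r ≤ κ m) → Eventually λ k → mesh k < ε
      bound (m , r≤κm) = m , λ k m≤k → *-cancelˡ-<-nonNeg (κ (suc k))
            {{pos⇒nonNeg (κ (suc k)) {{positive (κ-pos k)}}}} (begin-strict
        κ (suc k) * mesh k  ≡⟨ proj₂ (proj₂ (unit-fraction k)) ⟩
        1ℚ                  ≡⟨ εr≡1 ⟨
        ε * r               ≡⟨ *-comm ε r ⟩
        r * ε               ≤⟨ *-monoʳ (<⇒≤ 0<ε) (≤-trans r≤κm (κ-mono m≤k)) ⟩
        κ k * ε             <⟨ *-monoˡ-<-pos ε {{positive 0<ε}} {κ k} {κ (suc k)}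
              (<-from-diff {κ k} {κ (suc k)} 1ℚ 0<1 (+-comm 1ℚ (κ k))) ⟩
        κ (suc k) * ε       ∎)

  -- Descends from a known success until the next failure or 0.
  boundary : {P : ℕ → Set} → (∀ j → Dec (P j)) → ∀ j → P j →
    ∃[ i ] P i × (i ≡ 0 ⊎ ∃[ l ] i ≡ suc l × ¬ P l)
  boundary P? zero    p = 0 , p , inj₁ refl
  boundary P? (suc j) p with P? j
  ... | yes p′ = boundary P? j p′
  ... | no ¬p′ = suc j , p , inj₂ (j , refl , ¬p′)

  bounded-entries : (A : QMatrix n) → ∃[ B ] 0ℚ < B × ∀ i j → ∣ A i j ∣ ≤ B
  bounded-entries {n} A = forget (bounded-matrix {n} λ i j → fromℚ (A i j))
    where
    forget : (∃[ B ] 0ℚ < B × Eventually λ k → ∀ i j → ∣ A i j ∣ ≤ B) → ∃[ B ] 0ℚ < B × ∀ i j → ∣ A i j ∣ ≤ B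
    forget (B , 0<B , K , h) = B , 0<B , h K ℕ.≤-refl

  shift-PSD-large : ∀ (A : QMatrix n) {B q} → 0ℚ ≤ B → (∀ i j → ∣ A i j ∣ ≤ B) → B * κ n ≤ q → PSD (shift q A)
  shift-PSD-large {n} A {B} {q} 0≤B A≤B Bκ≤q x = subst (0ℚ ≤_) (sym (quad-shift q A x)) (diff-nonneg (begin
    quad A x                ≤⟨ quad-bound B A 0≤B A≤B x ⟩
    B * (κ n * (x ∙ x))     ≡⟨ *-assoc B (κ n) (x ∙ x) ⟨
    B * κ n * (x ∙ x)       ≤⟨ *-monoʳ (∙-nonneg x) Bκ≤q ⟩
    q * (x ∙ x)             ∎))
    where open ≤-Reasoning

  -- By `quad-bound`, changing the entries by at most `η` raises the form by at most η n (x ∙ x),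
  -- which the larger shift absorbs.
  shift-PSD-perturb : ∀ (A B : QMatrix n) {η μ ν} → 0ℚ ≤ η → (∀ i j → ∣ A i j - B i j ∣ ≤ η) →
    ν + η * κ n ≤ μ → PSD (shift ν B) → PSD (shift μ A)
  shift-PSD-perturb {n} A B {η} {μ} {ν} 0≤η A-B≤η ν≤μ psd x = subst (0ℚ ≤_) (sym (quad-shift μ A x))
        (diff-nonneg (begin
    quad A x
      ≡⟨ lemma₁ (quad A x) (quad B x) ⟩
    1ℚ * quad A x + (- 1ℚ) * quad B x + quad B x
      ≡⟨ cong (_+ quad B x) (quad-linear 1ℚ (- 1ℚ) A B x) ⟨
    quad (λ i j → 1ℚ * A i j + (- 1ℚ) * B i j) x + quad B x
      ≤⟨ +-mono-≤ (quad-bound η (λ i j → 1ℚ * A i j + (- 1ℚ) * B i j) 0≤η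
                    (λ i j → subst (λ p → ∣ p ∣ ≤ η) (lemma₂ (A i j) (B i j)) (A-B≤η i j)) x)
                  (≤-from-diff (ν * (x ∙ x) - quad B x) (subst (0ℚ ≤_) (quad-shift ν B x) (psd x))
                        (lemma₃ (ν * (x ∙ x)) (quad B x))) ⟩
    η * (κ n * (x ∙ x)) + ν * (x ∙ x)
      ≡⟨ lemma₄ η (κ n) (x ∙ x) ν ⟩
    (ν + η * κ n) * (x ∙ x)
      ≤⟨ *-monoʳ (∙-nonneg x) ν≤μ ⟩
    μ * (x ∙ x) ∎))
    where
    open ≤-Reasoning
    lemma₁ : ∀ a b → a ≡ 1ℚ * a + (- 1ℚ) * b + b
    lemma₁ = solve-∀ ring
    lemma₂ : ∀ a b → a - b ≡ 1ℚ * a + (- 1ℚ) * b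
    lemma₂ = solve-∀ ring
    lemma₃ : ∀ a b → a ≡ b + (a - b)
    lemma₃ = solve-∀ ring
    lemma₄ : ∀ η k s ν → η * (k * s) + ν * s ≡ (ν + η * k) * s
    lemma₄ = solve-∀ ring

  -- ν exceeds the largest eigenvalue of A, unless that is below q, by at most h.
  NearTop : ℚ → ℚ → QMatrix n → ℚ → Set
  NearTop q h A ν = q ≤ ν × PSD (shift ν A) × (ν ≡ q ⊎ ¬ PSD (shift (ν - h) A))

  abstract
    near-top : ∀ q k (A : QMatrix n) → Symm A → ∃[ ν ] NearTop q (mesh k) A ν
    near-top {n} q k A sym-A = go (bounded-entries A)
      where
      h : ℚ
      h = mesh k
      level : ℕ → ℚ
      level j = q + κ j * h
      q≤level : ∀ j → q ≤ level j
      q≤level j = ≤-from-diff {q} {q + κ j * h} (κ j * h) (*-nonneg (κ-nonneg j) (<⇒≤ (mesh-pos k))) refl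
      lemma : ∀ q κ h → q + (1ℚ + κ) * h - h ≡ q + κ * h
      lemma = solve-∀ ring
      lemma₀ : ∀ q h → q + 0ℚ * h ≡ q
      lemma₀ = solve-∀ ring
      lemma₁ : ∀ b q → b ≡ q + (b - q) * 1ℚ
      lemma₁ = solve-∀ ring
      choose : (∃[ j ] PSD (shift (level j) A) × (j ≡ 0 ⊎ ∃[ l ] j ≡ suc l × ¬ PSD (shift (level l) A))) →
        ∃[ ν ] NearTop q h A ν
      choose (j , psd , inj₁ refl) = level 0 , q≤level 0 , psd , inj₁ (lemma₀ q h)
      choose (j , psd , inj₂ (l , refl , ¬psd)) = level (suc l) , q≤level (suc l) , psd ,
        inj₂ (¬psd ∘ subst (λ ν → PSD (shift ν A)) (lemma q (κ l) h))
      go : (∃[ B ] 0ℚ < B × ∀ i j → ∣ A i j ∣ ≤ B) → ∃[ ν ] NearTop q h A ν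
      -- The factor k + 1 is the reciprocal of the mesh: `J` steps from `q` reach B n, a shift that
      -- is certainly positive semidefinite.
      go (B , 0<B , A≤B) = search (archimedean ((B * κ n - q) * κ (suc k)))
        where
        open ≤-Reasoning
        search : (∃[ J ] (B * κ n - q) * κ (suc k) ≤ κ J) → ∃[ ν ] NearTop q h A ν
        search (J , r≤κJ) = choose (boundary (λ j → PSD? (shift (level j) A) (shift-symm (level j) sym-A)) J
          (shift-PSD-large A (<⇒≤ 0<B) A≤B (begin
            B * κ n                                  ≡⟨ lemma₁ (B * κ n) q ⟩
            q + (B * κ n - q) * 1ℚ                   ≡⟨ cong (λ s → q + (B * κ n - q) * s)
                  (proj₂ (proj₂ (unit-fraction k))) ⟨
            q + (B * κ n - q) * (κ (suc k) * h)      ≡⟨ cong (q +_) (*-assoc (B * κ n - q) (κ (suc k)) h) ⟨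
            q + (B * κ n - q) * κ (suc k) * h        ≤⟨ +-monoʳ-≤ q (*-monoʳ (<⇒≤ (mesh-pos k)) r≤κJ) ⟩
            q + κ J * h                              ∎)))

  -- If `μ` is above `q`, the shift μ - h fails for `A`. Were ν + η n at most μ - h, perturbing from
  -- `B` to `A` would make that shift succeed.
  near-top-close : ∀ (A B : QMatrix n) {q h h′ η μ ν} → 0ℚ ≤ h → 0ℚ ≤ η → (∀ i j → ∣ A i j - B i j ∣ ≤ η) →
    NearTop q h A μ → NearTop q h′ B ν → μ ≤ ν + (h + η * κ n)
  near-top-close {n} A B {q} {h} {h′} {η} {μ} {ν} 0≤h 0≤η A-B≤η (_ , _ , inj₁ refl) (q≤ν , _ , _) =
    ≤-trans q≤ν (≤-from-diff {ν} {ν + (h + η * κ n)} (h + η * κ n) (+-nonneg 0≤h (*-nonneg 0≤η (κ-nonneg n))) refl)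
  near-top-close {n} A B {q} {h} {h′} {η} {μ} {ν} 0≤h 0≤η A-B≤η (_ , _ , inj₂ ¬psd) (_ , psd , _) =
    conclude (ν + η * κ n ≤? μ - h)
    where
    lemma : ∀ μ ν h r → ν + (h + r) ≡ μ + (ν + r - (μ - h))
    lemma = solve-∀ ring
    conclude : Dec (ν + η * κ n ≤ μ - h) → μ ≤ ν + (h + η * κ n)
    conclude (yes ν≤μ) = contradiction (shift-PSD-perturb A B {ν = ν} 0≤η A-B≤η ν≤μ psd) ¬psd
    conclude (no ν≰μ)  = ≤-from-diff (ν + η * κ n - (μ - h)) (<⇒≤ (diff-pos (≰⇒> ν≰μ))) (lemma μ ν h (η * κ n))

  -- Phrased as `Eventually` in the threshold `K`, so that `eventually-∀` merges the moduli of all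
  -- entries.
  uniformly-cauchy : (M : Matrix n) → ∀ ε → 0ℚ < ε →
    Eventually λ K → ∀ i j k l → K ℕ.≤ k → K ℕ.≤ l → ∣ seq (M i j) k - seq (M i j) l ∣ < ε
  uniformly-cauchy M ε 0<ε = eventually-∀ λ i → eventually-∀ λ j → tails (cauchy (M i j) ε 0<ε)
    where
    tails : ∀ {R : ℕ → ℕ → Set} → ∃[ N ] (∀ k l → N ℕ.≤ k → N ℕ.≤ l → R k l) →
      Eventually λ K → ∀ k l → K ℕ.≤ k → K ℕ.≤ l → R k l
    tails (N , h) = N , λ K N≤K k l K≤k K≤l → h k l (ℕ.≤-trans N≤K K≤k) (ℕ.≤-trans N≤K K≤l)

  module _ (M : Matrix n) (sym-M : ∀ k → Symm (at M k)) (q : ℚ) where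

    approximation : ∀ k → ∃[ ν ] NearTop q (mesh k) (at M k) ν
    approximation k = near-top q k (at M k) (sym-M k)

    topSeq : ℕ → ℚ
    topSeq k = proj₁ (approximation k)

    topSeq-near : ∀ k → NearTop q (mesh k) (at M k) (topSeq k)
    topSeq-near k = proj₂ (approximation k)

    topSeq-cauchy : IsCauchy topSeq
    -- `η` is ε/(n + 1): one share for the mesh, n shares for the perturbation of the entries.
    topSeq-cauchy ε 0<ε = go (divide (κ-pos n) 0<ε)
      where
      go : (∃[ η ] 0ℚ < η × κ (suc n) * η ≡ ε) →
        ∃[ N ] ∀ k l → N ℕ.≤ k → N ℕ.≤ l → ∣ topSeq k - topSeq l ∣ < ε
      go (η , 0<η , κη≡ε) = close (eventually-∃ (eventually-× mesh-small′ (uniformly-cauchy M η 0<η)))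
        where
        mesh-small′ : Eventually λ K → ∀ k → K ℕ.≤ k → mesh k < η
        mesh-small′ = proj₁ (mesh-small η 0<η) , λ K N≤K k K≤k → proj₂ (mesh-small η 0<η) k (ℕ.≤-trans N≤K K≤k)
        lemma : ∀ μ ν h η κ → (1ℚ + κ) * η ≡ μ - ν + ((ν + (h + η * κ) - μ) + (η - h))
        lemma = solve-∀ ring
        lemma′ : ∀ μ ν → ν - μ ≡ - (μ - ν)
        lemma′ = solve-∀ ring
        one-sided : ∀ k l → mesh k < η → (∀ i j → ∣ seq (M i j) k - seq (M i j) l ∣ < η) → topSeq k - topSeq l < ε
        one-sided k l h<η M<η = subst (topSeq k - topSeq l <_) κη≡ε
          (<-from-diff ((topSeq l + (mesh k + η * κ n) - topSeq k) + (η - mesh k))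
            (+-mono-≤-< (diff-nonneg (near-top-close (at M k) (at M l) (<⇒≤ (mesh-pos k)) (<⇒≤ 0<η)
                          (λ i j → <⇒≤ (M<η i j)) (topSeq-near k) (topSeq-near l))) (diff-pos h<η))
            (lemma (topSeq k) (topSeq l) (mesh k) η (κ n)))
        close : (∃[ K ] (∀ k → K ℕ.≤ k → mesh k < η) ×
                  (∀ i j k l → K ℕ.≤ k → K ℕ.≤ l → ∣ seq (M i j) k - seq (M i j) l ∣ < η)) →
          ∃[ N ] ∀ k l → N ℕ.≤ k → N ℕ.≤ l → ∣ topSeq k - topSeq l ∣ < ε
        close (K , small , M<η) = K , λ k l K≤k K≤l → ∣p∣<q
          (one-sided k l (small k K≤k) (λ i j → M<η i j k l K≤k K≤l))
          (subst (_< ε) (lemma′ (topSeq k) (topSeq l))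
            (one-sided l k (small l K≤l) (λ i j → M<η i j l k K≤l K≤k)))

    top : ℝ
    top = mkℝ topSeq topSeq-cauchy

    top-matrix : Matrix n
    top-matrix i j = fromℚ (- 1ℚ) *ℝ M i j +ℝ top *ℝ fromℚ (I i j)

    singular⇒eigenvalue : Singular top-matrix → IsEigenvalue M top
    singular⇒eigenvalue (x , x≉0 , Nx≈0) = x , (λ x≈0 → x≉0 λ i → ≈0⇒Null (x i) (x≈0 i)) ,
      λ i ε 0<ε → eventually-map (λ {k} → subst (_< ε) (eq i k)) (Nx≈0 i ε 0<ε)
      where
      open ≡-Reasoning
      lemma : ∀ p r → (- 1ℚ) * p + r ≡ - (p - r)
      lemma = solve-∀ ring
      eq : ∀ i k → ∣ at top-matrix k i ∙ atᵛ x k ∣ ≡ ∣ seq ((M · x) i) k - topSeq k * seq (x i) k ∣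
      eq i k = begin
        ∣ shift (topSeq k) (at M k) i ∙ atᵛ x k ∣
          ≡⟨ cong ∣_∣ (∙-linearˡ (- 1ℚ) (topSeq k) (at M k i) (I i) (atᵛ x k)) ⟩
        ∣ (- 1ℚ) * (at M k i ∙ atᵛ x k) + topSeq k * (I i ∙ atᵛ x k) ∣
          ≡⟨ cong (λ s → ∣ (- 1ℚ) * (at M k i ∙ atᵛ x k) + topSeq k * s ∣) (∙-I (atᵛ x k) i) ⟩
        ∣ (- 1ℚ) * (at M k i ∙ atᵛ x k) + topSeq k * seq (x i) k ∣
          ≡⟨ cong ∣_∣ (lemma (at M k i ∙ atᵛ x k) (topSeq k * seq (x i) k)) ⟩
        ∣ - (at M k i ∙ atᵛ x k - topSeq k * seq (x i) k) ∣
          ≡⟨ ∣-p∣≡∣p∣ (at M k i ∙ atᵛ x k - topSeq k * seq (x i) k) ⟩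
        ∣ at M k i ∙ atᵛ x k - topSeq k * seq (x i) k ∣
          ≡⟨ cong (λ s → ∣ s - topSeq k * seq (x i) k ∣) (seq-· M x i k) ⟨
        ∣ seq ((M · x) i) k - topSeq k * seq (x i) k ∣ ∎

    -- A coercive form stays positive semidefinite one mesh step further down, so the search for topSeq k
    -- must have stopped at q.
    coercive⇒PSD : Coercive top-matrix → Eventually λ k → PSD (shift q (at M k))
    coercive⇒PSD (L , 0<L , coercive) = go (divide 0<L 0<1)
      where
      lemma : ∀ L h ν s m → L * ((ν - h) * s - m) ≡ (L * (ν * s - m) - s) + (1ℚ - L * h) * s
      lemma = solve-∀ ring
      step : ∀ {k} → (∀ x → x ∙ x ≤ L * quad (at top-matrix k) x) × L * mesh k ≤ 1ℚ → PSD (shift q (at M k))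
      step {k} (coercive , Lh≤1) = stopped (topSeq-near k)
        where
        lower : PSD (shift (topSeq k - mesh k) (at M k))
        lower x = subst (0ℚ ≤_) (sym (quad-shift (topSeq k - mesh k) (at M k) x)) (*-cancel-nonneg 0<L
          (subst (0ℚ ≤_) (sym (lemma L (mesh k) (topSeq k) (x ∙ x) (quad (at M k) x)))
            (+-nonneg
              (diff-nonneg (subst (λ s → x ∙ x ≤ L * s) (quad-shift (topSeq k) (at M k) x) (coercive x)))
              (*-nonneg (diff-nonneg Lh≤1) (∙-nonneg x)))))
        stopped : NearTop q (mesh k) (at M k) (topSeq k) → PSD (shift q (at M k))
        stopped (_ , psd , inj₁ ν≡q)  = subst (λ ν → PSD (shift ν (at M k))) ν≡q psd
        stopped (_ , _   , inj₂ ¬psd) = contradiction lower ¬psd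
      go : (∃[ η ] 0ℚ < η × L * η ≡ 1ℚ) → Eventually λ k → PSD (shift q (at M k))
      go (η , 0<η , Lη≡1) = eventually-map step (eventually-× coercive
        (eventually-map (λ h<η → ≤-trans (*-monoˡ (<⇒≤ 0<L) (<⇒≤ h<η)) (≤-reflexive Lη≡1)) (mesh-small η 0<η)))

    -- In the coercive case q I - M would be positive semidefinite at some late stage, which `x`
    -- forbids. So `top` is an eigenvalue, and no term of it is below `q`, the lowest grid point.
    rayleigh : ∀ x → Eventually (λ k → q * (x ∙ x) < quad (at M k) x) →
      ¬ ¬ (∃[ ν ] IsEigenvalue M ν × ∀ k → q ≤ seq ν k)
    rayleigh x qxx<quad ¬eigenvalue = singular-or-coercive top-matrix
      (λ k → shift-symm (topSeq k) (sym-M k))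
      (0 , λ k _ → proj₁ (proj₂ (topSeq-near k))) (λ where
        (inj₁ singular) → ¬eigenvalue (top , singular⇒eigenvalue singular , λ k → proj₁ (topSeq-near k))
        (inj₂ coercive) → absurd (eventually-∃ (eventually-× qxx<quad (coercive⇒PSD coercive))))
      where
      absurd : ¬ (∃[ k ] (q * (x ∙ x) < quad (at M k) x × PSD (shift q (at M k))))
      absurd (k , lt , psd) = <-irrefl refl (<-≤-trans (subst (_< 0ℚ) (sym (quad-shift q (at M k) x))
        (subst₂ _<_ (lemma (q * (x ∙ x)) (quad (at M k) x)) refl (neg-antimono-< (diff-pos lt)))) (psd x))
        where
        lemma : ∀ a b → - (b - a) ≡ a - b
        lemma = solve-∀ ring

  -- Fractional perfect matchings from permutations

  χ : Bool → ℚ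
  χ b = if b then 1ℚ else 0ℚ

  0≤χ : ∀ b → 0ℚ ≤ χ b
  0≤χ true  = <⇒≤ 0<1
  0≤χ false = ≤-refl

  χ≤1 : ∀ b → χ b ≤ 1ℚ
  χ≤1 true  = ≤-refl
  χ≤1 false = <⇒≤ 0<1

  seq-if : ∀ b (x : ℝ) k → seq (if b then x else 0ℝ) k ≡ χ b * seq x k
  seq-if true  x k = sym (*-identityˡ (seq x k))
  seq-if false x k = sym (*-zeroˡ (seq x k))

  ≤⇒≤ℝ : ∀ x y → (∀ k → seq x k ≤ seq y k) → x ≤ℝ y
  ≤⇒≤ℝ x y x≤y (ε , 0<ε , K , y+ε<x) = <-irrefl refl (begin-strict
    seq y K        <⟨ <-from-diff {seq y K} {seq y K + ε} ε 0<ε refl ⟩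
    seq y K + ε    <⟨ y+ε<x K ℕ.≤-refl ⟩
    seq x K        ≤⟨ x≤y K ⟩
    seq y K        ∎)
    where open ≤-Reasoning

  listSum : ∀ {A : Set} → (A → ℚ) → List A → ℚ
  listSum h []       = 0ℚ
  listSum h (x ∷ xs) = h x + listSum h xs

  module _ {A : Set} (h : A → ℚ) where

    ∑-lookup : ∀ xs → ∑ (λ e → h (lookup xs e)) ≡ listSum h xs
    ∑-lookup []       = refl
    ∑-lookup (x ∷ xs) = cong (λ s → h x + s) (∑-lookup xs)

    listSum-filter : ∀ p xs → listSum h (filterᵇ p xs) ≡ listSum (λ x → χ (p x) * h x) xs
    listSum-filter p []       = refl
    listSum-filter p (x ∷ xs) with p x
    ... | true  = cong₂ _+_ (sym (*-identityˡ (h x))) (listSum-filter p xs)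
    ... | false = trans (listSum-filter p xs)
      (sym (trans (cong (λ t → t + listSum (λ x → χ (p x) * h x) xs) (*-zeroˡ (h x))) (+-identityˡ _)))

    listSum-++ : ∀ xs ys → listSum h (xs ++ ys) ≡ listSum h xs + listSum h ys
    listSum-++ []       ys = sym (+-identityˡ (listSum h ys))
    listSum-++ (x ∷ xs) ys = trans (cong (λ s → h x + s) (listSum-++ xs ys))
          (sym (+-assoc (h x) (listSum h xs) (listSum h ys)))

    listSum-map : ∀ {B : Set} (f : B → A) ys → listSum h (List.map f ys) ≡ listSum (h ∘ f) ys
    listSum-map f []       = refl
    listSum-map f (y ∷ ys) = cong (λ s → h (f y) + s) (listSum-map f ys)

    listSum-tabulate : ∀ (f : Fin n → A) → listSum h (List.tabulate f) ≡ ∑ (h ∘ f)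
    listSum-tabulate {zero}  f = refl
    listSum-tabulate {suc n} f = cong (λ s → h (f zero) + s) (listSum-tabulate (f ∘ suc))

  listSum-cartesianProduct : ∀ {A B : Set} (h : A × B → ℚ) xs ys →
    listSum h (cartesianProduct xs ys) ≡ listSum (λ x → listSum (λ y → h (x , y)) ys) xs
  listSum-cartesianProduct h []       ys = refl
  listSum-cartesianProduct h (x ∷ xs) ys = trans (listSum-++ h (List.map (x ,_) ys) (cartesianProduct xs ys))
    (cong₂ _+_ (listSum-map h (x ,_) ys) (listSum-cartesianProduct h xs ys))

  isEdge : Graph n → Fin n → Fin n → Bool
  isEdge G u w = does (u Fin.<? w) ∧ adj G u w

  -- Trades positions in the edge list for a double sum over vertices, which can be transposed.
  edge-sum : ∀ (G : Graph n) (h : Fin n × Fin n → ℚ) →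
    ∑ (λ e → h (lookup (edges G) e)) ≡ ∑ λ u → ∑ λ w → χ (isEdge G u w) * h (u , w)
  edge-sum {n} G h = begin
    ∑ (λ e → h (lookup (edges G) e))
      ≡⟨ ∑-lookup h (edges G) ⟩
    listSum h (edges G)
      ≡⟨ listSum-filter h (λ (u , w) → isEdge G u w) (cartesianProduct (List.allFin n) (List.allFin n)) ⟩
    listSum h′ (cartesianProduct (List.allFin n) (List.allFin n))
      ≡⟨ listSum-cartesianProduct h′ (List.allFin n) (List.allFin n) ⟩
    listSum (λ u → listSum (λ w → h′ (u , w)) (List.allFin n)) (List.allFin n)
      ≡⟨ listSum-tabulate (λ u → listSum (λ w → h′ (u , w)) (List.allFin n)) id ⟩
    ∑ (λ u → listSum (λ w → h′ (u , w)) (List.allFin n))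
      ≡⟨ sum-cong-≗ {n} (λ u → listSum-tabulate (λ w → h′ (u , w)) id) ⟩
    (∑ λ u → ∑ λ w → h′ (u , w)) ∎
    where
    open ≡-Reasoning
    h′ : Fin n × Fin n → ℚ
    h′ (u , w) = χ (isEdge G u w) * h (u , w)

  -- Of the two orderings of an edge exactly one is listed; equal ends are excluded by looplessness.
  orientation : ∀ (G : Graph n) {u w} → adj G u w ≡ true → χ (isEdge G u w) + χ (isEdge G w u) ≡ 1ℚ
  orientation G {u} {w} uw with Fin.<-cmp u w
  ... | tri< u<w _ w≮u = cong₂ (λ b c → χ (b ∧ adj G u w) + χ (c ∧ adj G w u)) (dec-true (u Fin.<? w) u<w)
        (dec-false (w Fin.<? u) w≮u)
                           ⟨ trans ⟩ cong (λ b → χ b + 0ℚ) uw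
  ... | tri> u≮w _ w<u = cong₂ (λ b c → χ (b ∧ adj G u w) + χ (c ∧ adj G w u)) (dec-false (u Fin.<? w) u≮w)
        (dec-true (w Fin.<? u) w<u)
                           ⟨ trans ⟩ cong (λ b → 0ℚ + χ b) (trans (symmetric G w u) uw)
  ... | tri≈ _ refl _ = contradiction (trans (sym (loopless G u)) uw) λ ()

  -- The sum counts the preimages of `v` under `σ`.
  ∑-I-injective : ∀ {m} (σ : Fin m → Fin n) → Injective σ → ∀ v → ∑ (λ u → I v (σ u)) ≤ 1ℚ
  ∑-I-injective {m = zero}  σ injective v = <⇒≤ 0<1
  ∑-I-injective {m = suc m} σ injective v with v Fin.≟ σ zero
  ... | no  _   = ≤-trans (≤-reflexive (+-identityˡ _)) (∑-I-injective (σ ∘ suc) (Fin.suc-injective ∘ injective) v)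
  ... | yes v≡σ₀ = ≤-reflexive (trans (cong (λ s → 1ℚ + s) (∑-zero (λ u → I v (σ (suc u))) zeros)) (+-identityʳ 1ℚ))
    where
    zeros : ∀ u → I v (σ (suc u)) ≡ 0ℚ
    zeros u with v Fin.≟ σ (suc u)
    ... | yes v≡σᵤ = contradiction (injective (trans (sym v≡σ₀) v≡σᵤ)) λ ()
    ... | no _     = refl

  ½κ≡/2 : ∀ n → ½ * κ n ≡ ℤ.+ n / 2
  ½κ≡/2 n = trans (cong (λ p → ½ * p) (κ≡/1 n)) (toℚᵘ-injective (begin
    toℚᵘ (½ * (ℤ.+ n / 1))                           ≈⟨ toℚᵘ-homo-* ½ (ℤ.+ n / 1) ⟩
    toℚᵘ ½ ℚᵘ.* toℚᵘ (ℤ.+ n / 1)                     ≈⟨ ℚᵘ.*-congˡ {ℚᵘ.mkℚᵘ (ℤ.+ 1) 1}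
          (toℚᵘ-fromℚᵘ (ℚᵘ.mkℚᵘ (ℤ.+ n) 0)) ⟩
    ℚᵘ.mkℚᵘ (ℤ.+ 1) 1 ℚᵘ.* ℚᵘ.mkℚᵘ (ℤ.+ n) 0         ≈⟨ ℚᵘ.*≡* (cong (ℤ._* ℤ.+ 2) (ℤ.*-identityˡ (ℤ.+ n))) ⟩
    ℚᵘ.mkℚᵘ (ℤ.+ n) 1                                ≈⟨ ℚᵘ.≃-sym (toℚᵘ-fromℚᵘ (ℚᵘ.mkℚᵘ (ℤ.+ n) 1)) ⟩
    toℚᵘ (ℤ.+ n / 2)                                 ∎))
    where open ℚᵘ.≃-Reasoning

  module _ (G : Graph n) (σ : Fin n → Fin n) (injective : Injective σ) (σ-adj : ∀ v → adj G v (σ v) ≡ true) where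

    -- Every vertex v contributes ½ to the edge {v, σ v}.
    weight : Fin n × Fin n → ℚ
    weight (u , w) = ½ * (I (σ u) w + I (σ w) u)

    -- Double counting. Transposing the second half of the weight turns it into arcs from u to
    -- `σ u`; each arc is then met once in either orientation, by `orientation`. Constant `c` yields
    -- the total weight, and `incidence v` the load of the vertex `v`.
    weighted-sum : ∀ (c : Fin n → Fin n → ℚ) → (∀ u w → c u w ≡ c w u) →
      ∑ (λ e → let u , w = lookup (edges G) e in c u w * weight (u , w)) ≡ ½ * ∑ λ u → c u (σ u)
    weighted-sum c c-symm = begin
      ∑ (λ e → let u , w = lookup (edges G) e in c u w * weight (u , w))
        ≡⟨ edge-sum G (λ (u , w) → c u w * weight (u , w)) ⟩
      (∑ λ u → ∑ λ w → χ (isEdge G u w) * (c u w * weight (u , w)))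
        ≡⟨ sum-cong-≗ {n} (λ u → trans (sum-cong-≗ {n} λ w → lemma₁ (χ (isEdge G u w)) (c u w) (I (σ u) w)
              (I (σ w) u))
             (∑-distrib-+ {n} (arc u) (arcᵀ u))) ⟩
      (∑ λ u → ∑ (arc u) + ∑ (arcᵀ u))
        ≡⟨ ∑-distrib-+ {n} (λ u → ∑ (arc u)) (λ u → ∑ (arcᵀ u)) ⟩
      (∑ λ u → ∑ λ w → arc u w) + (∑ λ u → ∑ λ w → arcᵀ u w)
        ≡⟨ cong (λ s → (∑ λ u → ∑ λ w → arc u w) + s) (∑-comm {n} {n} arcᵀ) ⟩
      (∑ λ u → ∑ λ w → arc u w) + (∑ λ u → ∑ λ w → arcᵀ w u)
        ≡⟨ ∑-distrib-+ {n} (λ u → ∑ (arc u)) (λ u → ∑ λ w → arcᵀ w u) ⟨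
      (∑ λ u → ∑ (arc u) + (∑ λ w → arcᵀ w u))
        ≡⟨ sum-cong-≗ {n} (λ u → trans (sym (∑-distrib-+ {n} (arc u) (λ w → arcᵀ w u)))
             (trans (sum-cong-≗ {n} (both u)) (∙-I (λ w → ½ * c u w) (σ u)))) ⟩
      (∑ λ u → ½ * c u (σ u))
        ≡⟨ *-distribˡ-sum {n} ½ (λ u → c u (σ u)) ⟨
      (½ * ∑ λ u → c u (σ u)) ∎
      where
      open ≡-Reasoning
      arc arcᵀ : Fin n → Fin n → ℚ
      arc u w = χ (isEdge G u w) * (I (σ u) w * (½ * c u w))
      arcᵀ u w = χ (isEdge G u w) * (I (σ w) u * (½ * c u w))
      lemma₁ : ∀ x c i j → x * (c * (½ * (i + j))) ≡ x * (i * (½ * c)) + x * (j * (½ * c))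
      lemma₁ = solve-∀ ring
      lemma₂ : ∀ x y z → x * z + y * z ≡ (x + y) * z
      lemma₂ = solve-∀ ring
      lemma₃ : ∀ x c → x * (0ℚ * c) ≡ 0ℚ * c
      lemma₃ = solve-∀ ring
      support : ∀ u w → (χ (isEdge G u w) + χ (isEdge G w u)) * (I (σ u) w * (½ * c u w)) ≡ I (σ u) w * (½ * c u w)
      support u w with σ u Fin.≟ w
      ... | yes refl = trans (cong (λ t → t * (1ℚ * (½ * c u (σ u)))) (orientation G (σ-adj u))) (*-identityˡ _)
      ... | no  _    = lemma₃ (χ (isEdge G u w) + χ (isEdge G w u)) (½ * c u w)
      both : ∀ u w → arc u w + arcᵀ w u ≡ I (σ u) w * (½ * c u w)
      both u w = begin
        arc u w + χ (isEdge G w u) * (I (σ u) w * (½ * c w u))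
          ≡⟨ cong (λ t → arc u w + χ (isEdge G w u) * (I (σ u) w * (½ * t))) (c-symm w u) ⟩
        arc u w + χ (isEdge G w u) * (I (σ u) w * (½ * c u w))
          ≡⟨ lemma₂ (χ (isEdge G u w)) (χ (isEdge G w u)) (I (σ u) w * (½ * c u w)) ⟩
        (χ (isEdge G u w) + χ (isEdge G w u)) * (I (σ u) w * (½ * c u w))
          ≡⟨ support u w ⟩
        I (σ u) w * (½ * c u w) ∎

    matching : Edge G → ℝ
    matching e = fromℚ (weight (lookup (edges G) e))

    weight-nonneg : ∀ e → 0ℚ ≤ weight e
    weight-nonneg (u , w) = *-nonneg (<⇒≤ 0<½) (+-nonneg (0≤χ (does (σ u Fin.≟ w))) (0≤χ (does (σ w Fin.≟ u))))

    weight≤1 : ∀ e → weight e ≤ 1ℚ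
    weight≤1 (u , w) = *-monoˡ (<⇒≤ 0<½) (+-mono-≤ (χ≤1 (does (σ u Fin.≟ w))) (χ≤1 (does (σ w Fin.≟ u))))

    incidence : Fin n → Fin n → Fin n → ℚ
    incidence v u w = χ (does (v Fin.≟ u) ∨ does (v Fin.≟ w))

    incidence≤ : ∀ v u w → incidence v u w ≤ I v u + I v w
    incidence≤ v u w = χ-∨ (does (v Fin.≟ u)) (does (v Fin.≟ w))
      where
      χ-∨ : ∀ b c → χ (b ∨ c) ≤ χ b + χ c
      χ-∨ true  c = ≤-from-diff (χ c) (0≤χ c) refl
      χ-∨ false c = ≤-reflexive (sym (+-identityˡ (χ c)))

    -- `v` carries ½ as the tail of its own arc and at most ½ as the head of another, by
    -- injectivity.
    vertex-sum≤1 : ∀ v → ½ * ∑ (λ u → incidence v u (σ u)) ≤ 1ℚ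
    vertex-sum≤1 v = begin
      ½ * ∑ (λ u → incidence v u (σ u))
        ≤⟨ *-monoˡ (<⇒≤ 0<½) (∑-mono {n} (λ u → incidence≤ v u (σ u))) ⟩
      ½ * ∑ (λ u → I v u + I v (σ u))
        ≡⟨ cong (λ s → ½ * s) (∑-distrib-+ {n} (I v) (λ u → I v (σ u))) ⟩
      ½ * (∑ (I v) + ∑ (λ u → I v (σ u)))
        ≤⟨ *-monoˡ (<⇒≤ 0<½) (+-mono-≤ (∑-I-injective id id v) (∑-I-injective σ injective v)) ⟩
      ½ * (1ℚ + 1ℚ)
        ≡⟨⟩
      1ℚ ∎
      where open ≤-Reasoning

    hasFPM : HasFractionalPerfectMatching G
    hasFPM = matching , ((λ e → ≤⇒≤ℝ 0ℝ (matching e) (λ _ → weight-nonneg (lookup (edges G) e)) ,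
                                ≤⇒≤ℝ (matching e) 1ℝ (λ _ → weight≤1 (lookup (edges G) e))) ,
                         (λ v → ≤⇒≤ℝ (sum (λ e → if incident G v e then matching e else 0ℝ)) 1ℝ (λ k →
                           subst (_≤ 1ℚ) (sym (vertex-sum v k)) (vertex-sum≤1 v)))) ,
      λ ε 0<ε → 0 , λ k _ → subst (_< ε) (sym (cong ∣_∣ (trans (cong (_- (ℤ.+ n / 2)) (total k))
            (+-inverseʳ (ℤ.+ n / 2))))) 0<ε
      where
      vertex-sum : ∀ v k → seq (sum (λ e → if incident G v e then matching e else 0ℝ)) k ≡
        ½ * ∑ (λ u → incidence v u (σ u))
      vertex-sum v k = trans (seq-sum (λ e → if incident G v e then matching e else 0ℝ) k)
        (trans (sum-cong-≗ {length (edges G)} (λ e → seq-if (incident G v e) (matching e) k))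
          (weighted-sum (incidence v) λ u w → cong χ (∨-comm (does (v Fin.≟ u)) (does (v Fin.≟ w)))))
      total : ∀ k → seq (sum matching) k ≡ ℤ.+ n / 2
      total k = trans (seq-sum matching k)
        (trans (sum-cong-≗ {length (edges G)} (λ e → sym (*-identityˡ (weight (lookup (edges G) e)))))
          (trans (weighted-sum (λ _ _ → 1ℚ) (λ _ _ → refl)) (½κ≡/2 n)))

  -- Cliques

  -- A single term, taken late enough, is compared with -½η. If it were smaller, the tail would stay
  -- below -¼η and so witness the excluded `x <ℝ 0ℝ`.
  nonneg⇒eventually : ∀ x → 0ℝ ≤ℝ x → ∀ η → 0ℚ < η → Eventually λ k → - η ≤ seq x k
  nonneg⇒eventually x 0≤x η 0<η = go (cauchy x (½ * (½ * η)) 0<¼η)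
    where
    ζ = ½ * (½ * η)
    0<¼η : 0ℚ < ζ
    0<¼η = *-pos 0<½ (*-pos 0<½ 0<η)
    lemma₁ : ∀ η p q → p ≡ - η + ((½ * (½ * η) - - (p - q)) + (½ * (½ * η) + (½ * η + q)))
    lemma₁ = solve-∀ ring
    lemma₂ : ∀ η p q → 0ℚ ≡ p + ½ * (½ * η) + ((½ * (½ * η) - (p - q)) + (0ℚ - (½ * η + q)))
    lemma₂ = solve-∀ ring
    go : ∃[ K ] (∀ k l → K ℕ.≤ k → K ℕ.≤ l → ∣ seq x k - seq x l ∣ < ζ) → Eventually λ k → - η ≤ seq x k
    go (K , close) = K , λ k K≤k → ≤-from-diff ((ζ - - (seq x k - seq x K)) + (ζ + (½ * η + seq x K)))
      (+-nonneg (<⇒≤ (diff-pos (≤-<-trans (-p≤∣p∣ (seq x k - seq x K)) (close k K K≤k ℕ.≤-refl))))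
        (+-nonneg (<⇒≤ 0<¼η) (decide (0ℚ ≤? ½ * η + seq x K))))
      (lemma₁ η (seq x k) (seq x K))
      where
      decide : Dec (0ℚ ≤ ½ * η + seq x K) → 0ℚ ≤ ½ * η + seq x K
      decide (yes 0≤) = 0≤
      decide (no 0≰)  = contradiction (ζ , 0<¼η , K , λ k K≤k → <-from-diff
            ((ζ - (seq x k - seq x K)) + (0ℚ - (½ * η + seq x K)))
        (+-mono-< (diff-pos (≤-<-trans (p≤∣p∣ (seq x k - seq x K)) (close k K K≤k ℕ.≤-refl))) (diff-pos (≰⇒> 0≰)))
        (lemma₂ η (seq x k) (seq x K))) 0≤x

  separate : ∀ x y → x <ℝ y → ∃[ q ] ∃[ τ ] 0ℚ < τ ×
    Eventually (λ k → seq x k + τ < q) × Eventually (λ k → q + τ < seq y k)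
  separate x y (ε , 0<ε , L , x+ε<y) = go (cauchy x τ 0<τ)
    where
    τ = ½ * (½ * ε)
    0<τ : 0ℚ < τ
    0<τ = *-pos 0<½ (*-pos 0<½ 0<ε)
    lemma₁ : ∀ ε p q → q + ½ * ε ≡ p + ½ * (½ * ε) + (½ * (½ * ε) - (p - q))
    lemma₁ = solve-∀ ring
    lemma₂ : ∀ ε p q r → r ≡ q + ½ * ε + ½ * (½ * ε) + ((½ * (½ * ε) - - (p - q)) + (r - (p + ε)))
    lemma₂ = solve-∀ ring
    go : ∃[ K ] (∀ k l → K ℕ.≤ k → K ℕ.≤ l → ∣ seq x k - seq x l ∣ < τ) → ∃[ q ] ∃[ τ ] 0ℚ < τ ×
      Eventually (λ k → seq x k + τ < q) × Eventually (λ k → q + τ < seq y k)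
    -- Half the gap above a late term of `x`: one quarter of `ε` covers the oscillation of `x`, and
    -- a margin of another quarter is left on either side.
    go (K , close) = seq x K + ½ * ε , τ , 0<τ ,
      (K , λ k K≤k → <-from-diff (τ - (seq x k - seq x K))
        (diff-pos (≤-<-trans (p≤∣p∣ (seq x k - seq x K)) (close k K K≤k ℕ.≤-refl))) (lemma₁ ε (seq x k) (seq x K))) ,
      (K ℕ.⊔ L , λ k K⊔L≤k → <-from-diff ((τ - - (seq x k - seq x K)) + (seq y k - (seq x k + ε)))
        (+-mono-< (diff-pos (≤-<-trans (-p≤∣p∣ (seq x k - seq x K)) (close k K (ℕ.m⊔n≤o⇒m≤o K L K⊔L≤k) ℕ.≤-refl)))
                  (diff-pos (x+ε<y k (ℕ.m⊔n≤o⇒n≤o K L K⊔L≤k))))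
        (lemma₂ ε (seq x k) (seq x K) (seq y k)))

  ∑χ : (T : Subset n) → ∑ (λ i → χ (Vec.lookup T i)) ≡ κ Subset.∣ T ∣
  ∑χ []              = refl
  ∑χ (inside  ∷ T) = cong (λ s → 1ℚ + s) (∑χ T)
  ∑χ (outside ∷ T) = trans (+-identityˡ _) (∑χ T)

  ∑-adj : (G : Graph n) → ∀ u → ∑ (λ v → χ (adj G u v)) ≡ κ (degree G u)
  ∑-adj {n} G u = trans (sum-cong-≗ {n} λ v → cong χ (sym (lookup∘tabulate (adj G u) v))) (∑χ (neighbours G u))

  indicator : Subset n → Vector ℚ n
  indicator T i = χ (Vec.lookup T i)

  χ-idem : ∀ b → χ b * χ b ≡ χ b
  χ-idem true  = refl
  χ-idem false = refl

  χ-scale-≤ : ∀ b {q r} → (b ≡ true → q ≤ r) → χ b * (q * χ b) ≤ χ b * r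
  χ-scale-≤ true  {q}     q≤r = *-monoˡ (<⇒≤ 0<1) (≤-trans (≤-reflexive (*-identityʳ q)) (q≤r refl))
  χ-scale-≤ false {q} {r} q≤r = ≤-reflexive (trans (*-zeroˡ (q * 0ℚ)) (sym (*-zeroˡ r)))

  module _ (a : ℝ) (H : Graph n) where

    entry : ∀ k u v → at (aD+A a H) k u v ≡ seq a k * (I u v * κ (degree H u)) + χ (adj H u v)
    entry k u v = cong₂ (λ p q → seq a k * p + q)
      (trans (seq-if (does (u Fin.≟ v)) (fromℕ (degree H u)) k) (cong (λ p → I u v * p) (sym (κ≡/1 (degree H u)))))
      (trans (seq-if (adj H u v) 1ℝ k) (*-identityʳ _))

    aD+A-symm : ∀ k → Symm (at (aD+A a H) k)
    aD+A-symm k u v = trans (entry k u v) (trans (cong₂ (λ p b → seq a k * p + χ b) diagonal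
          (symmetric H u v)) (sym (entry k v u)))
      where
      diagonal : I u v * κ (degree H u) ≡ I v u * κ (degree H v)
      diagonal with u Fin.≟ v | v Fin.≟ u
      ... | yes refl | yes _   = refl
      ... | no _     | no _    = trans (*-zeroˡ (κ (degree H u))) (sym (*-zeroˡ (κ (degree H v))))
      ... | yes refl | no v≢u  = contradiction refl v≢u
      ... | no u≢v   | yes v≡u = contradiction (sym v≡u) u≢v

    row-sum : ∀ k u x → at (aD+A a H) k u ∙ x ≡ seq a k * (κ (degree H u) * x u) + (λ v → χ (adj H u v)) ∙ x
    row-sum k u x = begin
      at (aD+A a H) k u ∙ x
        ≡⟨ sum-cong-≗ {n} (λ v → trans (cong (λ p → p * x v) (entry k u v))
              (lemma₁ (seq a k) (κ (degree H u)) (I u v) (χ (adj H u v)) (x v))) ⟩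
      ∑ (λ v → seq a k * κ (degree H u) * (I u v * x v) + χ (adj H u v) * x v)
        ≡⟨ ∑-distrib-+ {n} (λ v → seq a k * κ (degree H u) * (I u v * x v)) (λ v → χ (adj H u v) * x v) ⟩
      ∑ (λ v → seq a k * κ (degree H u) * (I u v * x v)) + (λ v → χ (adj H u v)) ∙ x
        ≡⟨ cong (λ s → s + (λ v → χ (adj H u v)) ∙ x) (trans
              (sym (*-distribˡ-sum {n} (seq a k * κ (degree H u)) (λ v → I u v * x v)))
             (trans (cong (λ s → seq a k * κ (degree H u) * s) (∙-I x u))
                   (*-assoc (seq a k) (κ (degree H u)) (x u)))) ⟩
      seq a k * (κ (degree H u) * x u) + (λ v → χ (adj H u v)) ∙ x ∎
      where
      open ≡-Reasoning
      lemma₁ : ∀ a d i c x → (a * (i * d) + c) * x ≡ a * d * (i * x) + c * x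
      lemma₁ = solve-∀ ring

    IsClique : Subset n → Set
    IsClique T = ∀ {u v} → u ∈ T → v ∈ T → u ≢ v → adj H u v ≡ true

    module _ (T : Subset n) (clique : IsClique T) (d : ℕ) (d<∣T∣ : d ℕ.< Subset.∣ T ∣) where

      x : Vector ℚ n
      x = indicator T

      inner-degree : Fin n → ℚ
      inner-degree u = (λ v → χ (adj H u v)) ∙ x

      -- Every vertex of `T` is `u` or a neighbour of `u`, so ∣T∣ ≤ 1 + `inner-degree u`; the strict
      -- inequality d < ∣T∣ absorbs the 1.
      inner-degree-large : ∀ {u} → u ∈ T → κ d ≤ inner-degree u
      inner-degree-large {u} u∈T = ≤-from-diff {κ d} {inner-degree u} (1ℚ + inner-degree u - (1ℚ + κ d))
            (diff-nonneg (begin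
        1ℚ + κ d                                    ≤⟨ κ-mono d<∣T∣ ⟩
        κ Subset.∣ T ∣                              ≡⟨ ∑χ T ⟨
        ∑ x                                         ≤⟨ ∑-mono {n} bound ⟩
        ∑ (λ v → I u v + χ (adj H u v) * x v)       ≡⟨ ∑-distrib-+ {n} (I u) (λ v → χ (adj H u v) * x v) ⟩
        ∑ (I u) + inner-degree u                    ≤⟨ +-monoˡ-≤ (inner-degree u) (∑-I-injective id id u) ⟩
        1ℚ + inner-degree u                         ∎)) (lemma (κ d) (inner-degree u))
        where
        open ≤-Reasoning
        lemma : ∀ p q → q ≡ p + (1ℚ + q - (1ℚ + p))
        lemma = solve-∀ ring
        bound : ∀ v → x v ≤ I u v + χ (adj H u v) * x v
        bound v with u Fin.≟ v | Vec.lookup T v in v∈T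
        ... | yes _  | b     = ≤-trans (χ≤1 b) (≤-from-diff (χ (adj H u v) * χ b)
              (*-nonneg (0≤χ (adj H u v)) (0≤χ b)) refl)
        ... | no _   | false = ≤-reflexive (sym (trans (+-identityˡ _) (*-zeroʳ (χ (adj H u v)))))
        ... | no u≢v | true  rewrite clique u∈T (lookup⇒[]= v T v∈T) u≢v = ≤-refl

      inner-degree≤degree : ∀ u → inner-degree u ≤ κ (degree H u)
      inner-degree≤degree u = begin
        inner-degree u              ≤⟨ ∑-mono {n} (λ v → *-monoˡ (0≤χ (adj H u v)) (χ≤1 (Vec.lookup T v))) ⟩
        ∑ (λ v → χ (adj H u v) * 1ℚ)  ≡⟨ sum-cong-≗ {n} (λ v → *-identityʳ (χ (adj H u v))) ⟩
        ∑ (λ v → χ (adj H u v))       ≡⟨ ∑-adj H u ⟩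
        κ (degree H u)              ∎
        where open ≤-Reasoning

      degree≤n : ∀ u → κ (degree H u) ≤ κ n
      degree≤n u = subst (_≤ κ n) (∑-adj H u) (∑-mono {n} (λ v → χ≤1 (adj H u v)))

      -- The row is a D + S with D ≥ S ≥ d, that is (a + 1) d + a (D - d) + (S - d). As the
      -- approximation of `a` may be as low as -η, the middle term can cost η (D - d) ≤ η n, hence
      -- the reserve η n in the hypothesis.
      row-large : ∀ k {q η} → - η ≤ seq a k → 0ℚ ≤ η → q + η * κ n ≤ (seq a k + 1ℚ) * κ d →
        ∀ {u} → u ∈ T → q ≤ at (aD+A a H) k u ∙ x
      row-large k {q} {η} -η≤a 0≤η q≤ {u} u∈T = ≤-from-diff {q}
          (((seq a k + 1ℚ) * κ d - (q + η * κ n)) + (seq a k - - η) * (D - κ d) + η * (κ n - (D - κ d)) + (S - κ d))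
        (+-nonneg (+-nonneg (+-nonneg (diff-nonneg q≤)
          (*-nonneg (diff-nonneg -η≤a) (diff-nonneg (≤-trans (inner-degree-large u∈T) (inner-degree≤degree u)))))
          (*-nonneg 0≤η (diff-nonneg (≤-trans (≤-from-diff {D - κ d} {D} (κ d) (κ-nonneg d)
                (lemma₁ D (κ d))) (degree≤n u)))))
          (diff-nonneg (inner-degree-large u∈T)))
        (trans (row-sum k u x)
          (trans (cong (λ p → seq a k * (D * χ p) + S) ([]=⇒lookup u∈T))
            (lemma₂ (seq a k) D (κ d) S q η (κ n))))
        where
        D = κ (degree H u)
        S = inner-degree u
        lemma₁ : ∀ D d → D ≡ D - d + d
        lemma₁ = solve-∀ ring
        lemma₂ : ∀ a D d S q η m → a * (D * 1ℚ) + S ≡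
          q + (((a + 1ℚ) * d - (q + η * m)) + (a - - η) * (D - d) + η * (m - (D - d)) + (S - d))
        lemma₂ = solve-∀ ring

      x∙x≡∣T∣ : x ∙ x ≡ κ Subset.∣ T ∣
      x∙x≡∣T∣ = trans (sum-cong-≗ {n} (λ v → χ-idem (Vec.lookup T v))) (∑χ T)

      0<x∙x : 0ℚ < x ∙ x
      0<x∙x = subst (0ℚ <_) (sym x∙x≡∣T∣) (<-≤-trans (κ-pos d) (κ-mono d<∣T∣))

      quad-large : ∀ k {q} → (∀ {u} → u ∈ T → q ≤ at (aD+A a H) k u ∙ x) → q * (x ∙ x) ≤ quad (at (aD+A a H) k) x
      quad-large k {q} rows = begin
        q * (x ∙ x)                   ≡⟨ ∙-scaleʳ q x x ⟨
        (x ∙ λ u → q * x u)           ≤⟨ ∑-mono {n} bound ⟩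
        quad (at (aD+A a H) k) x      ∎
        where
        open ≤-Reasoning
        bound : ∀ u → x u * (q * x u) ≤ x u * (at (aD+A a H) k u ∙ x)
        bound u = χ-scale-≤ (Vec.lookup T u) λ u∈T → rows (lookup⇒[]= u T u∈T)

      clique⇒eigenvalue-large : 0ℝ ≤ℝ a → ∀ λ₁ → IsLargestEigenvalue (aD+A a H) λ₁ → ¬ (λ₁ <ℝ (a +ℝ 1ℝ) *ℝ fromℕ d)
      clique⇒eigenvalue-large 0≤a λ₁ (_ , largest) λ₁<a = go (separate λ₁ ((a +ℝ 1ℝ) *ℝ fromℕ d) λ₁<a)
        where
        go : ¬ (∃[ q ] ∃[ τ ] 0ℚ < τ × Eventually (λ k → seq λ₁ k + τ < q) ×
                Eventually (λ k → q + τ < (seq a k + 1ℚ) * (ℤ.+ d / 1)))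
        -- The margin is shared out: n parts `η` for the reserve of `row-large`, and one more to
        -- make the Rayleigh inequality at `q` strict.
        go (q , τ , 0<τ , λ₁<q , q<a) = refute (divide (κ-pos n) (*-pos 0<½ 0<τ))
          where
          refute : ¬ (∃[ η ] 0ℚ < η × κ (suc n) * η ≡ ½ * τ)
          refute (η , 0<η , κη≡½τ) = rayleigh (aD+A a H) aD+A-symm q x
            (eventually-map (λ {k} (-η≤a , lt) → step k -η≤a lt) (eventually-× (nonneg⇒eventually a 0≤a η 0<η) q<a))
            -- The eigenvalue is available only under a double negation, which suffices for an
            -- absurd goal; λ₁ + τ < q ≤ ν contradicts maximality.
            λ (ν , eigen , q≤ν) → largest ν eigen (τ , 0<τ , proj₁ λ₁<q , λ k K≤k → <-≤-trans
                  (proj₂ λ₁<q k K≤k) (q≤ν k))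
            where
            lemma : ∀ q τ η m → q + τ ≡ q + η + η * m + (τ - (1ℚ + m) * η)
            lemma = solve-∀ ring
            step : ∀ k → - η ≤ seq a k → q + τ < (seq a k + 1ℚ) * (ℤ.+ d / 1) → q * (x ∙ x) < quad (at (aD+A a H) k) x
            step k -η≤a lt = begin-strict
              q * (x ∙ x)             <⟨ *-monoˡ-<-pos (x ∙ x) {{positive 0<x∙x}} {q} {q + η}
                    (<-from-diff {q} {q + η} η 0<η refl) ⟩
              (q + η) * (x ∙ x)       ≤⟨ quad-large k {q + η} (row-large k {q + η} {η} -η≤a (<⇒≤ 0<η) (begin
                q + η + η * κ n             ≤⟨ ≤-from-diff {q + η + η * κ n} {q + τ} (τ - (1ℚ + κ n) * η)
                                                 (diff-nonneg (≤-trans (≤-reflexive κη≡½τ) ½τ≤τ))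
                                                       (lemma q τ η (κ n)) ⟩
                q + τ                       ≤⟨ <⇒≤ lt ⟩
                (seq a k + 1ℚ) * (ℤ.+ d / 1)  ≡⟨ cong (λ p → (seq a k + 1ℚ) * p) (κ≡/1 d) ⟨
                (seq a k + 1ℚ) * κ d        ∎)) ⟩
              quad (at (aD+A a H) k) x ∎
              where
              open ≤-Reasoning
              half : ∀ τ → τ ≡ ½ * τ + ½ * τ
              half = solve-∀ ring
              ½τ≤τ : ½ * τ ≤ τ
              ½τ≤τ = ≤-from-diff (½ * τ) (*-nonneg (<⇒≤ 0<½) (<⇒≤ 0<τ)) (half τ)

  independent⇒clique : ∀ (G : Graph n) {T} → Independent G T → ∀ {u v} → u ∈ T → v ∈ T → u ≢ v →
    adj (complement G) u v ≡ true
  independent⇒clique G independent {u} {v} u∈T v∈T u≢v =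
    cong₂ (λ b c → not b ∧ not c) (dec-false (u Fin.≟ v) u≢v) (independent u∈T v∈T)

open import Data.Nat.Base using (ℕ; _∸_; _*_; _≤_)

corollary4p5 : ∀ (a : ℝ) → 0ℝ ≤ℝ a →
    ∀ (n : ℕ) (G : Graph n) → Connected G →
    ∀ (δ : ℕ) → IsMinDegree G δ → 2 * δ ≤ n ∸ 1 →
    ∀ (λ₁ : ℝ) → IsLargestEigenvalue (aD+A a (complement G)) λ₁ →
    λ₁ <ℝ (a +ℝ 1ℝ) *ℝ fromℕ δ →
    HasFractionalPerfectMatching G
corollary4p5 a 0≤a n G _ δ (_ , δ≤degree) _ λ₁ largest λ₁< = conclude (hall-or-violation (neighbours G))
  where
  open HallTheorem
  open SpectralBound

  match : Transversal (neighbours G) → HasFractionalPerfectMatching G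
  match (σ , injective , σ∈) = hasFPM G σ injective λ v → ∈-tabulate⁻ (adj G v) (σ∈ v)

  refute : ¬ (∃[ T ] Independent G T × δ ℕ.< Subset.∣ T ∣)
  refute (T , independent , δ<∣T∣) =
    clique⇒eigenvalue-large a (complement G) T (independent⇒clique G independent) δ δ<∣T∣ 0≤a λ₁ largest λ₁<

  conclude : Hall (neighbours G) ⊎ Violation (neighbours G) → HasFractionalPerfectMatching G
  conclude (inj₁ hall)      = match (hall⇒transversal (neighbours G) hall)
  conclude (inj₂ violation) = contradiction (violation⇒independent G δ≤degree violation) refute
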